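{- Let $k_1,k_2,k_3\in\mathbb{Z}_{\ge0}$ and let $(P,Q,R)$ be a $(k_1,k_2,k_3)$-CGC triple associated with the non-labeled cluster $(a,b,c)$ such that $|b|>\max\{|a|,|c|\}$. Then there exists a unique Markov-monodromy decomposition $(X,Y,Z)$ of $(P,Q,R)$.
   Context: Fix $k_1,k_2,k_3\in\mathbb{Z}_{\ge0}$, indeterminates $x_1,x_2,x_3$. Mutations: $\mu_1(a,b,c)=(\frac{b^2+k_1bc+c^2}{a},b,c)$, $\mu_2(a,b,c)=(a,\frac{a^2+k_2ac+c^2}{b},c)$, $\mu_3(a,b,c)=(a,b,\frac{a^2+k_3ab+b^2}{c})$. Labeled clusters of $\mathcal{A}(k_1,k_2,k_3)$: triples obtained from $(x_1,x_2,x_3)$ by finitely many mutations; non-labeled clusters: permutations of labeled clusters; cluster variables: their entries; a cluster variable $y$ occurs in a unique position $i$ among labeled clusters, and its parity is $k_y:=k_i$. $|a|$ is the value of a Laurent polynomial $a$ at $x_1=x_2=x_3=1$. $\mathscr{M}=\frac{x_1^2+x_2^2+x_3^2+k_1x_2x_3+k_2x_1x_3+k_3x_1x_2}{x_1x_2x_3}$, $T=\begin{bmatrix}-1&0\\ \mathscr{M}&-1\end{bmatrix}$, and for a $2\times2$ matrix $P=(p_{ij})$, $S_P=\begin{bmatrix}\mathscr{M}p_{12}-\mathrm{tr}P&0\\(\mathscr{M}p_{12}-\mathrm{tr}P)\mathscr{M}&\mathscr{M}p_{12}-\mathrm{tr}P\end{bmatrix}$. A CGC matrix is $P\in SL(2,\mathbb{Z}[x_1^{\pm1},x_2^{\pm1},x_3^{\pm1}])$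 with $(1,2)$-entry $p_{12}$ a cluster variable and $\mathrm{tr}P=\mathscr{M}p_{12}-k_{p_{12}}$; a CGC triple is a triple $(P,Q,R)$ of CGC matrices with $Q=PR-S_Q$ and $(p_{12},q_{12},r_{12})$ a non-labeled cluster (associated cluster). A CMM matrix is $X\in SL(2,\mathbb{Z}[x_1^{\pm1},x_2^{\pm1},x_3^{\pm1}])$ with $(1,2)$-entry $x_{12}$ a cluster variable and $\mathrm{tr}X=-k_{x_{12}}$; a CMM triple is a triple $(X,Y,Z)$ of CMM matrices with $XYZ=T$ and $(x_{12},y_{12},z_{12})$ a non-labeled cluster. A Markov-monodromy decomposition of a CGC triple $(P,Q,R)$ associated with $(a,b,c)$ is a triple $(X,Y,Z)$ such that (1) $(X,Y,Z)$ is a CMM triple; (2) $P=-(YZ)^{ -1}$, $Q=-(XZ)^{ -1}$, $R=-(XY)^{ -1}$; (3) $\mathrm{tr}X=-k_a$, $\mathrm{tr}Y=-k_b$, $\mathrm{tr}Z=-k_c$. -}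

module Defs where

open import Data.Nat using (ℕ)
open import Data.Integer as ℤ using (ℤ; +_; -[1+_])
open import Data.Bool using (Bool; _∧_; if_then_else_)
open import Data.List using (List; []; _∷_; _++_; map; concatMap; foldr)
open import Data.Product using (_×_; _,_; Σ; ∃; ∃-syntax)
open import Data.Sum using (_⊎_)
open import Relation.Nullary.Decidable using (⌊_⌋)
open import Relation.Binary.PropositionalEquality using (_≡_)

-- The Laurent polynomial ring ℤ[x₁^{±1}, x₂^{±1}, x₃^{±1}]
-- represented as finite formal sums of terms c·x₁^e₁ x₂^e₂ x₃^e₃,
-- with equality "all coefficients agree" (a setoid).

record Mono : Set where
  constructor mono
  field
    e₁ e₂ e₃ : ℤ

sameMono : Mono → Mono → Bool
sameMono (mono a b c) (mono a' b' c') =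
  ⌊ a ℤ.≟ a' ⌋ ∧ ⌊ b ℤ.≟ b' ⌋ ∧ ⌊ c ℤ.≟ c' ⌋

monoMul : Mono → Mono → Mono
monoMul (mono a b c) (mono a' b' c') = mono (a ℤ.+ a') (b ℤ.+ b') (c ℤ.+ c')

Laurent : Set
Laurent = List (ℤ × Mono)

coeff : Laurent → Mono → ℤ
coeff [] m = + 0
coeff ((c , m') ∷ p) m = if sameMono m' m then c ℤ.+ coeff p m else coeff p m

infix 4 _≈_
_≈_ : Laurent → Laurent → Set
p ≈ q = ∀ m → coeff p m ≡ coeff q m

infixl 6 _+_ _-_
infixl 7 _*_

_+_ : Laurent → Laurent → Laurent
p + q = p ++ q

-_ : Laurent → Laurent
- p = map (λ { (c , m) → (ℤ.- c , m) }) p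

_-_ : Laurent → Laurent → Laurent
p - q = p + (- q)

_*_ : Laurent → Laurent → Laurent
p * q = concatMap (λ { (c , m) → map (λ { (d , n) → (c ℤ.* d , monoMul m n) }) q }) p

zeroL : Laurent
zeroL = []

cst : ℤ → Laurent
cst c = (c , mono (+ 0) (+ 0) (+ 0)) ∷ []

κ : ℕ → Laurent
κ k = cst (+ k)

x₁ x₂ x₃ : Laurent
x₁ = (+ 1 , mono (+ 1) (+ 0) (+ 0)) ∷ []
x₂ = (+ 1 , mono (+ 0) (+ 1) (+ 0)) ∷ []
x₃ = (+ 1 , mono (+ 0) (+ 0) (+ 1)) ∷ []

x123⁻¹ : Laurent
x123⁻¹ = (+ 1 , mono -[1+ 0 ] -[1+ 0 ] -[1+ 0 ]) ∷ []

-- |a| : value at x₁ = x₂ = x₃ = 1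
∣_∣ : Laurent → ℤ
∣ p ∣ = foldr (λ { (c , _) s → c ℤ.+ s }) (+ 0) p

module _ (k₁ k₂ k₃ : ℕ) where

  -- Labeled clusters, generated from (x₁,x₂,x₃) by mutations.  The
  -- quotient in a mutation is specified as an element a' with
  -- a · a' = numerator (unique up to ≈, the ring being a domain).
  data Labeled : Laurent → Laurent → Laurent → Set where
    base : ∀ {a b c} → a ≈ x₁ → b ≈ x₂ → c ≈ x₃ → Labeled a b c
    mut₁ : ∀ {a b c a'} → Labeled a b c →
           a * a' ≈ b * b + κ k₁ * b * c + c * c → Labeled a' b c
    mut₂ : ∀ {a b c b'} → Labeled a b c →
           b * b' ≈ a * a + κ k₂ * a * c + c * c → Labeled a b' c
    mut₃ : ∀ {a b c c'} → Labeled a b c →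
           c * c' ≈ a * a + κ k₃ * a * b + b * b → Labeled a b c'

  LabeledCluster : Laurent → Laurent → Laurent → Set
  LabeledCluster a b c = ∃[ a' ] ∃[ b' ] ∃[ c' ]
    (Labeled a' b' c' × a ≈ a' × b ≈ b' × c ≈ c')

  NonLabeledCluster : Laurent → Laurent → Laurent → Set
  NonLabeledCluster a b c =
    LabeledCluster a b c ⊎ LabeledCluster a c b ⊎ LabeledCluster b a c ⊎
    LabeledCluster b c a ⊎ LabeledCluster c a b ⊎ LabeledCluster c b a

  -- Parity y k : y is a cluster variable occurring in position i of a
  -- labeled cluster, and k = k_i  (i.e. k = k_y).
  data Parity (y : Laurent) : ℕ → Set where
    pos₁ : ∀ {a b c} → Labeled a b c → y ≈ a → Parity y k₁
    pos₂ : ∀ {a b c} → Labeled a b c → y ≈ b → Parity y k₂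
    pos₃ : ∀ {a b c} → Labeled a b c → y ≈ c → Parity y k₃

  ClusterVariable : Laurent → Set
  ClusterVariable y = ∃[ k ] Parity y k

  𝓜 : Laurent
  𝓜 = (x₁ * x₁ + x₂ * x₂ + x₃ * x₃ + κ k₁ * x₂ * x₃ + κ k₂ * x₁ * x₃ + κ k₃ * x₁ * x₂) * x123⁻¹

record Mat : Set where
  constructor mat
  field
    m₁₁ m₁₂ m₂₁ m₂₂ : Laurent
open Mat public

infix 4 _≈M_
_≈M_ : Mat → Mat → Set
A ≈M B = m₁₁ A ≈ m₁₁ B × m₁₂ A ≈ m₁₂ B × m₂₁ A ≈ m₂₁ B × m₂₂ A ≈ m₂₂ B

infixl 7 _·_
_·_ : Mat → Mat → Mat
A · B = mat (m₁₁ A * m₁₁ B + m₁₂ A * m₂₁ B) (m₁₁ A * m₁₂ B + m₁₂ A * m₂₂ B)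
            (m₂₁ A * m₁₁ B + m₂₂ A * m₂₁ B) (m₂₁ A * m₁₂ B + m₂₂ A * m₂₂ B)

infixl 6 _⊖_
_⊖_ : Mat → Mat → Mat
A ⊖ B = mat (m₁₁ A - m₁₁ B) (m₁₂ A - m₁₂ B) (m₂₁ A - m₂₁ B) (m₂₂ A - m₂₂ B)

negM : Mat → Mat
negM A = mat (- m₁₁ A) (- m₁₂ A) (- m₂₁ A) (- m₂₂ A)

tr : Mat → Laurent
tr A = m₁₁ A + m₂₂ A

det : Mat → Laurent
det A = m₁₁ A * m₂₂ A - m₁₂ A * m₂₁ A

-- adjugate; equals the inverse for matrices of determinant 1
inv : Mat → Mat
inv A = mat (m₂₂ A) (- m₁₂ A) (- m₂₁ A) (m₁₁ A)

InSL2 : Mat → Set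
InSL2 A = det A ≈ cst (+ 1)

module _ (k₁ k₂ k₃ : ℕ) where

  T : Mat
  T = mat (cst -[1+ 0 ]) zeroL (𝓜 k₁ k₂ k₃) (cst -[1+ 0 ])

  S : Mat → Mat
  S P = mat s zeroL (s * 𝓜 k₁ k₂ k₃) s
    where s = 𝓜 k₁ k₂ k₃ * m₁₂ P - tr P

  CGCMatrix : Mat → Set
  CGCMatrix P = InSL2 P ×
    ∃[ k ] (Parity k₁ k₂ k₃ (m₁₂ P) k × tr P ≈ 𝓜 k₁ k₂ k₃ * m₁₂ P - κ k)

  CGCTriple : Mat → Mat → Mat → Laurent → Laurent → Laurent → Set
  CGCTriple P Q R a b c =
    CGCMatrix P × CGCMatrix Q × CGCMatrix R ×
    Q ≈M P · R ⊖ S Q ×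
    m₁₂ P ≈ a × m₁₂ Q ≈ b × m₁₂ R ≈ c ×
    NonLabeledCluster k₁ k₂ k₃ a b c

  CMMMatrix : Mat → Set
  CMMMatrix X = InSL2 X ×
    ∃[ k ] (Parity k₁ k₂ k₃ (m₁₂ X) k × tr X ≈ - κ k)

  CMMTriple : Mat → Mat → Mat → Set
  CMMTriple X Y Z =
    CMMMatrix X × CMMMatrix Y × CMMMatrix Z ×
    X · Y · Z ≈M T ×
    NonLabeledCluster k₁ k₂ k₃ (m₁₂ X) (m₁₂ Y) (m₁₂ Z)

  TraceParity : Mat → Laurent → Set
  TraceParity X a = ∃[ k ] (Parity k₁ k₂ k₃ a k × tr X ≈ - κ k)

  MMDecomposition : Mat → Mat → Mat → Laurent → Laurent → Laurent →
                    Mat → Mat → Mat → Set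
  MMDecomposition P Q R a b c X Y Z =
    CMMTriple X Y Z ×
    P ≈M negM (inv (Y · Z)) × Q ≈M negM (inv (X · Z)) × R ≈M negM (inv (X · Y)) ×
    TraceParity X a × TraceParity Y b × TraceParity Z c

{-# OPTIONS --safe #-}

-- Uniqueness: X Y Z = T together with Y Z = − P⁻¹ and X Y = − R⁻¹ forces X = − T P, Z = − R T and
-- Y = P⁻¹ T⁻¹ R⁻¹.
--
-- Existence: Cayley–Hamilton for T Q turns Q = P R − S_Q into T P R T = − Q⁻¹, i.e. X Z = − Q⁻¹.
-- Write k, l, n for the numbers with tr P = M a − k, tr Q = M b − l, tr R = M c − n.  The
-- (1,2)-entry y of Y then satisfies b y = a² + l a c + c² and b + y = M a c − k c − n a, so y is the
-- mutation of b once l is known to be the parity of the position which b occupies in the cluster.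
-- The two relations give M a b c = a² + b² + c² + k b c + l a c + n a b.  Every labeled cluster
-- satisfies the same equation with its own positional parities, and its mutations can be undone
-- over the positive rationals, so it takes all positive rational values under ring homomorphisms
-- from the Laurent ring to ℚ; comparing the equations at (1,1,1) and at the points with one
-- coordinate doubled identifies the parities.

module Submission where

open import Algebra.Bundles using (CommutativeRing)
open import Algebra.Core using (Op₁; Op₂)
import Algebra.Solver.Ring
open import Algebra.Solver.Ring.AlmostCommutativeRing using (_-Raw-AlmostCommutative⟶_; fromCommutativeRing)
open import Algebra.Structures using (IsMonoid)
open import Data.Bool using (true; false; if_then_else_)
open import Data.Empty using (⊥-elim)
open import Data.Integer as ℤ using (ℤ; +_; -[1+_]; _<_; _⊔_)
import Data.Integer.Properties as ℤ
open import Data.List using ([]; _∷_; map; length)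
open import Data.List.Properties using (++-assoc)
open import Data.Maybe using (Maybe; just; nothing)
open import Data.Nat as ℕ using (ℕ; zero; suc; z≤n; s≤s)
import Data.Nat.Properties as ℕ
open import Data.Nat.Coprimality as Coprimality using (1-coprimeTo)
open import Data.Product using (_×_; _,_; ∃-syntax; Σ; proj₁; proj₂)
open import Data.Rational as ℚ using (ℚ; mkℚ; 0ℚ; 1ℚ; Positive; NonNegative; 1/_)
import Data.Rational.Properties as ℚ
open import Data.Rational.Solver using (module +-*-Solver)
import Data.Rational.Unnormalised as ℚᵘ
import Data.Rational.Unnormalised.Properties as ℚᵘ
open import Data.Sum using (inj₁; inj₂)
open import Function using (_∘_; const)
open import Level using (0ℓ)
open import Relation.Binary.Core using (Rel)
import Relation.Binary.PropositionalEquality as ≡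
import Relation.Binary.Reasoning.Setoid as SetoidReasoning
open import Relation.Binary.Structures using (IsEquivalence)
open import Relation.Nullary using (yes; no)

-- Two-by-two matrices over a commutative ring

-- The factorization uses only monoid laws and signs. `inv` stands for the adjugate, which is
-- involutive on all matrices; that it gives inverses is assumed further down for T, P and R alone.
module Factorization
  {C : Set} {_≈_ : Rel C 0ℓ} {_·_ : Op₂ C} {I : C} (isMonoid : IsMonoid _≈_ _·_ I)
  (neg inv : Op₁ C)
  (neg-cong : ∀ {A B} → A ≈ B → neg A ≈ neg B)
  (neg-involutive : ∀ A → neg (neg A) ≈ A)
  (neg-distribˡ : ∀ A B → (neg A · B) ≈ neg (A · B))
  (neg-distribʳ : ∀ A B → (A · neg B) ≈ neg (A · B))
  (inv-cong : ∀ {A B} → A ≈ B → inv A ≈ inv B)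
  (inv-involutive : ∀ A → inv (inv A) ≈ A)
  (inv-neg : ∀ A → inv (neg A) ≈ neg (inv A))
  where

  open IsMonoid isMonoid
  open SetoidReasoning setoid

  -- The map A ↦ - A⁻¹ is an involution. It turns P = - (Y Z)⁻¹ and its analogues into formulas for
  -- the products of two factors, and back.
  neg-inv-swap : ∀ {A B} → A ≈ neg (inv B) → B ≈ neg (inv A)
  neg-inv-swap {A} {B} A≈ = begin
    B                     ≈⟨ neg-involutive B ⟨
    neg (neg B)           ≈⟨ neg-cong (neg-cong (inv-involutive B)) ⟨
    neg (neg (inv (inv B))) ≈⟨ neg-cong (inv-neg (inv B)) ⟨
    neg (inv (neg (inv B))) ≈⟨ neg-cong (inv-cong A≈) ⟨
    neg (inv A)           ∎

  neg·neg : ∀ A B → (neg A · neg B) ≈ (A · B)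
  neg·neg A B = trans (neg-distribˡ A (neg B)) (trans (neg-cong (neg-distribʳ A B)) (neg-involutive _))

  cancel-inner : ∀ A B {C D} → (C · D) ≈ I → ((A · C) · (D · B)) ≈ (A · B)
  cancel-inner A B {C} {D} CD≈I = begin
    (A · C) · (D · B)   ≈⟨ assoc A C (D · B) ⟩
    A · (C · (D · B))   ≈⟨ ∙-congˡ (assoc C D B) ⟨
    A · ((C · D) · B)   ≈⟨ ∙-congˡ (∙-congʳ CD≈I) ⟩
    A · (I · B)         ≈⟨ ∙-congˡ (identityˡ B) ⟩
    A · B               ∎

  module Factors {T P R : C}
    (T⁻¹T : (inv T · T) ≈ I) (TT⁻¹ : (T · inv T) ≈ I)
    (P⁻¹P : (inv P · P) ≈ I) (PP⁻¹ : (P · inv P) ≈ I)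
    (R⁻¹R : (inv R · R) ≈ I)
    where

    X Y Z : C
    X = neg (T · P)
    Y = (inv P · inv T) · inv R
    Z = neg (R · T)

    XY : (X · Y) ≈ neg (inv R)
    XY = begin
      neg (T · P) · Y                           ≈⟨ neg-distribˡ (T · P) Y ⟩
      neg ((T · P) · ((inv P · inv T) · inv R)) ≈⟨ neg-cong (∙-congˡ (assoc (inv P) (inv T) (inv R))) ⟩
      neg ((T · P) · (inv P · (inv T · inv R))) ≈⟨ neg-cong (cancel-inner T (inv T · inv R) PP⁻¹) ⟩
      -- A unit on the left supplies the outer factor that `cancel-inner` expects.
      neg (T · (inv T · inv R))                 ≈⟨ neg-cong (∙-congʳ (identityˡ T)) ⟨
      neg ((I · T) · (inv T · inv R))           ≈⟨ neg-cong (cancel-inner I (inv R) TT⁻¹) ⟩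
      neg (I · inv R)                           ≈⟨ neg-cong (identityˡ (inv R)) ⟩
      neg (inv R)                               ∎

    YZ : (Y · Z) ≈ neg (inv P)
    YZ = begin
      Y · neg (R · T)                             ≈⟨ neg-distribʳ Y (R · T) ⟩
      neg (((inv P · inv T) · inv R) · (R · T))   ≈⟨ neg-cong (cancel-inner (inv P · inv T) T R⁻¹R) ⟩
      neg ((inv P · inv T) · T)                   ≈⟨ neg-cong (∙-congˡ (identityʳ T)) ⟨
      neg ((inv P · inv T) · (T · I))             ≈⟨ neg-cong (cancel-inner (inv P) I T⁻¹T) ⟩
      neg (inv P · I)                             ≈⟨ neg-cong (identityʳ (inv P)) ⟩
      neg (inv P)                                 ∎

    XYZ : ((X · Y) · Z) ≈ T
    XYZ = begin
      (X · Y) · Z                ≈⟨ ∙-congʳ XY ⟩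
      neg (inv R) · neg (R · T)  ≈⟨ neg·neg (inv R) (R · T) ⟩
      inv R · (R · T)            ≈⟨ assoc (inv R) R T ⟨
      (inv R · R) · T            ≈⟨ ∙-congʳ R⁻¹R ⟩
      I · T                      ≈⟨ identityˡ T ⟩
      T                          ∎

    -- The two signs cancel. The remaining T P R T becomes - Q⁻¹ once P R is expressed through Q.
    XZ : (X · Z) ≈ ((T · (P · R)) · T)
    XZ = begin
      neg (T · P) · neg (R · T)  ≈⟨ neg·neg (T · P) (R · T) ⟩
      (T · P) · (R · T)          ≈⟨ assoc (T · P) R T ⟨
      ((T · P) · R) · T          ≈⟨ ∙-congʳ (assoc T P R) ⟩
      (T · (P · R)) · T          ∎

    module Unique {X' Y' Z' : C} (XYZ' : ((X' · Y') · Z') ≈ T)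
      (P≈ : P ≈ neg (inv (Y' · Z'))) (R≈ : R ≈ neg (inv (X' · Y'))) (RR⁻¹ : (R · inv R) ≈ I) where

      -- The condition on P says Y' Z' = - P⁻¹, so T = X' Y' Z' = - X' P⁻¹, which is solved for X'.
      X-unique : X' ≈ X
      X-unique = begin
        X'                            ≈⟨ identityʳ X' ⟨
        X' · I                        ≈⟨ ∙-congˡ P⁻¹P ⟨
        X' · (inv P · P)              ≈⟨ assoc X' (inv P) P ⟨
        (X' · inv P) · P              ≈⟨ neg·neg (X' · inv P) P ⟨
        neg (X' · inv P) · neg P      ≈⟨ ∙-congʳ (neg-distribʳ X' (inv P)) ⟨
        (X' · neg (inv P)) · neg P    ≈⟨ ∙-congʳ (∙-congˡ (neg-inv-swap P≈)) ⟨
        (X' · (Y' · Z')) · neg P      ≈⟨ ∙-congʳ (assoc X' Y' Z') ⟨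
        ((X' · Y') · Z') · neg P      ≈⟨ ∙-congʳ XYZ' ⟩
        T · neg P                     ≈⟨ neg-distribʳ T P ⟩
        neg (T · P)                   ∎

      Z-unique : Z' ≈ Z
      Z-unique = begin
        Z'                            ≈⟨ identityˡ Z' ⟨
        I · Z'                        ≈⟨ ∙-congʳ RR⁻¹ ⟨
        (R · inv R) · Z'              ≈⟨ assoc R (inv R) Z' ⟩
        R · (inv R · Z')              ≈⟨ neg·neg R (inv R · Z') ⟨
        neg R · neg (inv R · Z')      ≈⟨ ∙-congˡ (neg-distribˡ (inv R) Z') ⟨
        neg R · (neg (inv R) · Z')    ≈⟨ ∙-congˡ (∙-congʳ (neg-inv-swap R≈)) ⟨
        neg R · ((X' · Y') · Z')      ≈⟨ ∙-congˡ XYZ' ⟩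
        neg R · T                     ≈⟨ neg-distribˡ R T ⟩
        neg (R · T)                   ∎

      -- Since X' = - T P and X' Y' = - R⁻¹, the product T P Y' is R⁻¹; multiplying by P⁻¹ T⁻¹
      -- isolates Y'.
      Y-unique : Y' ≈ Y
      Y-unique = begin
        Y'                                             ≈⟨ identityˡ Y' ⟨
        I · Y'                                         ≈⟨ ∙-congʳ P⁻¹P ⟨
        (inv P · P) · Y'                               ≈⟨ ∙-congʳ (cancel-inner (inv P) P T⁻¹T) ⟨
        ((inv P · inv T) · (T · P)) · Y'               ≈⟨ assoc (inv P · inv T) (T · P) Y' ⟩
        (inv P · inv T) · ((T · P) · Y')               ≈⟨ ∙-congˡ (neg-involutive _) ⟨
        (inv P · inv T) · neg (neg ((T · P) · Y'))     ≈⟨ ∙-congˡ (neg-cong (neg-distribˡ (T · P) Y')) ⟨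
        (inv P · inv T) · neg (neg (T · P) · Y')       ≈⟨ ∙-congˡ (neg-cong (∙-congʳ X-unique)) ⟨
        (inv P · inv T) · neg (X' · Y')                ≈⟨ ∙-congˡ (neg-cong (neg-inv-swap R≈)) ⟩
        (inv P · inv T) · neg (neg (inv R))            ≈⟨ ∙-congˡ (neg-involutive _) ⟩
        (inv P · inv T) · inv R                        ∎

module Matrices (R : CommutativeRing 0ℓ 0ℓ)
  (ι-hom : ℤ.+-*-rawRing -Raw-AlmostCommutative⟶ fromCommutativeRing R) where

  open CommutativeRing R hiding (_-_)
  open _-Raw-AlmostCommutative⟶_ ι-hom using (0-homo; 1-homo) renaming (⟦_⟧ to ι)
  module ≈-R = SetoidReasoning setoid

  -- The solver needs only a sound test on its coefficients, which are integers; equality in the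
  -- ring itself is never decided.
  ι-≟ : ∀ i j → Maybe (ι i ≈ ι j)
  ι-≟ i j with i ℤ.≟ j
  ... | yes ≡.refl = just refl
  ... | no _ = nothing

  open Algebra.Solver.Ring ℤ.+-*-rawRing (fromCommutativeRing R) ι-hom ι-≟
    using (solve; _:+_; _:*_; :-_; _:-_; _:=_; con)

  infixl 6 _-_
  _-_ : Carrier → Carrier → Carrier
  x - y = x + (- y)

  record Mat₂ : Set where
    constructor mat₂
    field
      e₁₁ e₁₂ e₂₁ e₂₂ : Carrier
  open Mat₂ public

  infix 4 _≈₂_
  _≈₂_ : Rel Mat₂ 0ℓ
  A ≈₂ B = e₁₁ A ≈ e₁₁ B × e₁₂ A ≈ e₁₂ B × e₂₁ A ≈ e₂₁ B × e₂₂ A ≈ e₂₂ B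

  infixl 7 _·₂_
  _·₂_ : Op₂ Mat₂
  A ·₂ B = mat₂ (e₁₁ A * e₁₁ B + e₁₂ A * e₂₁ B) (e₁₁ A * e₁₂ B + e₁₂ A * e₂₂ B)
                (e₂₁ A * e₁₁ B + e₂₂ A * e₂₁ B) (e₂₁ A * e₁₂ B + e₂₂ A * e₂₂ B)

  neg₂ inv₂ : Op₁ Mat₂
  neg₂ A = mat₂ (- e₁₁ A) (- e₁₂ A) (- e₂₁ A) (- e₂₂ A)
  inv₂ A = mat₂ (e₂₂ A) (- e₁₂ A) (- e₂₁ A) (e₁₁ A)

  I₂ : Mat₂
  I₂ = mat₂ 1# 0# 0# 1#

  tr₂ det₂ : Mat₂ → Carrier
  tr₂ A = e₁₁ A + e₂₂ A
  det₂ A = e₁₁ A * e₂₂ A - e₁₂ A * e₂₁ A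

  ·-isMonoid : IsMonoid _≈₂_ _·₂_ I₂
  ·-isMonoid = record
    { isSemigroup = record
      { isMagma = record
        { isEquivalence = record
          { refl = refl , refl , refl , refl
          ; sym = λ (p , q , r , s) → sym p , sym q , sym r , sym s
          ; trans = λ (p , q , r , s) (p' , q' , r' , s') → trans p p' , trans q q' , trans r r' , trans s s' }
        ; ∙-cong = λ (p , q , r , s) (p' , q' , r' , s') →
            dot p q p' r' , dot p q q' s' , dot r s p' r' , dot r s q' s' }
      ; assoc = λ (mat₂ a b c d) (mat₂ e f g h) (mat₂ i j k l) →
          dot-assoc a b e f g h i k , dot-assoc a b e f g h j l , dot-assoc c d e f g h i k , dot-assoc c d e f g h j l }
    ; identity = (λ (mat₂ a b c d) → first-row a c , first-row b d , second-row a c , second-row b d)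
               , (λ (mat₂ a b c d) → first-column a b , second-column a b , first-column c d , second-column c d) }
    where
    dot : ∀ {a b c d a' b' c' d'} → a ≈ a' → b ≈ b' → c ≈ c' → d ≈ d' → a * c + b * d ≈ a' * c' + b' * d'
    dot p q r s = +-cong (*-cong p r) (*-cong q s)
    dot-assoc : ∀ a b e f g h i k →
      (a * e + b * g) * i + (a * f + b * h) * k ≈ a * (e * i + f * k) + b * (g * i + h * k)
    dot-assoc = solve 8 (λ a b e f g h i k →
      (a :* e :+ b :* g) :* i :+ (a :* f :+ b :* h) :* k := a :* (e :* i :+ f :* k) :+ b :* (g :* i :+ h :* k)) refl
    first-row : ∀ a c → 1# * a + 0# * c ≈ a
    first-row a c = trans (+-cong (*-identityˡ a) (zeroˡ c)) (+-identityʳ a)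
    second-row : ∀ a c → 0# * a + 1# * c ≈ c
    second-row a c = trans (+-cong (zeroˡ a) (*-identityˡ c)) (+-identityˡ c)
    first-column : ∀ a b → a * 1# + b * 0# ≈ a
    first-column a b = trans (+-cong (*-identityʳ a) (zeroʳ b)) (+-identityʳ a)
    second-column : ∀ a b → a * 0# + b * 1# ≈ b
    second-column a b = trans (+-cong (zeroʳ a) (*-identityʳ b)) (+-identityˡ b)

  open IsMonoid ·-isMonoid using () renaming (refl to ≈₂-refl; trans to ≈₂-trans; ∙-cong to ·-cong)

  neg-involutive : ∀ x → - (- x) ≈ x
  neg-involutive = solve 1 (λ x → :- (:- x) := x) refl

  neg-dotˡ : ∀ a b c d → (- a) * c + (- b) * d ≈ - (a * c + b * d)
  neg-dotˡ = solve 4 (λ a b c d → (:- a) :* c :+ (:- b) :* d := :- (a :* c :+ b :* d)) refl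

  neg-dotʳ : ∀ a b c d → a * (- c) + b * (- d) ≈ - (a * c + b * d)
  neg-dotʳ = solve 4 (λ a b c d → a :* (:- c) :+ b :* (:- d) := :- (a :* c :+ b :* d)) refl

  open Factorization ·-isMonoid neg₂ inv₂
    (λ (p , q , r , s) → -‿cong p , -‿cong q , -‿cong r , -‿cong s)
    (λ (mat₂ a b c d) → neg-involutive a , neg-involutive b , neg-involutive c , neg-involutive d)
    (λ (mat₂ a b c d) (mat₂ e f g h) → neg-dotˡ a b e g , neg-dotˡ a b f h , neg-dotˡ c d e g , neg-dotˡ c d f h)
    (λ (mat₂ a b c d) (mat₂ e f g h) → neg-dotʳ a b e g , neg-dotʳ a b f h , neg-dotʳ c d e g , neg-dotʳ c d f h)
    (λ (p , q , r , s) → s , -‿cong q , -‿cong r , p)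
    (λ (mat₂ a b c d) → refl , neg-involutive b , neg-involutive c , refl)
    (λ A → ≈₂-refl)
    public

  det-· : ∀ A B → det₂ (A ·₂ B) ≈ det₂ A * det₂ B
  det-· (mat₂ a b c d) (mat₂ e f g h) = solve 8 (λ a b c d e f g h →
    (a :* e :+ b :* g) :* (c :* f :+ d :* h) :- (a :* f :+ b :* h) :* (c :* e :+ d :* g)
      := (a :* d :- b :* c) :* (e :* h :- f :* g)) refl a b c d e f g h

  det-neg : ∀ A → det₂ (neg₂ A) ≈ det₂ A
  det-neg (mat₂ a b c d) = solve 4 (λ a b c d → (:- a) :* (:- d) :- (:- b) :* (:- c) := a :* d :- b :* c) refl a b c d

  det-inv : ∀ A → det₂ (inv₂ A) ≈ det₂ A
  det-inv (mat₂ a b c d) = solve 4 (λ a b c d → d :* a :- (:- b) :* (:- c) := a :* d :- b :* c) refl a b c d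

  det-·-1 : ∀ A B → det₂ A ≈ 1# → det₂ B ≈ 1# → det₂ (A ·₂ B) ≈ 1#
  det-·-1 A B p q = trans (det-· A B) (trans (*-cong p q) (*-identityˡ 1#))

  -- A matrix times its adjugate is its determinant times the identity.
  ·-inverseʳ : ∀ A → det₂ A ≈ 1# → A ·₂ inv₂ A ≈₂ I₂
  ·-inverseʳ (mat₂ a b c d) det≈1 =
      trans (solve 4 (λ a b c d → a :* d :+ b :* (:- c) := a :* d :- b :* c) refl a b c d) det≈1
    , trans (solve 2 (λ a b → a :* (:- b) :+ b :* a := con (+ 0)) refl a b) 0-homo
    , trans (solve 2 (λ c d → c :* d :+ d :* (:- c) := con (+ 0)) refl c d) 0-homo
    , trans (solve 4 (λ a b c d → c :* (:- b) :+ d :* a := a :* d :- b :* c) refl a b c d) det≈1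

  -- This is the right-hand law for the adjugate of A, whose own adjugate is A.
  ·-inverseˡ : ∀ A → det₂ A ≈ 1# → inv₂ A ·₂ A ≈₂ I₂
  ·-inverseˡ A det≈1 = ≈₂-trans (·-cong (≈₂-refl {inv₂ A}) (refl , sym (neg-involutive _) , sym (neg-involutive _) , refl))
    (·-inverseʳ (inv₂ A) (trans (det-inv A) det≈1))

  -- The matrix T and the entries and traces of the three factors

  module Triple (M : Carrier) where

    -- The constants are images of integers, so that the solver can read them as `con`. In the
    -- Laurent ring the corner is then `cst (+ 0)`, which equals `zeroL` only up to `≈`.
    T₂ : Mat₂
    T₂ = mat₂ (ι -[1+ 0 ]) (ι (+ 0)) M (ι -[1+ 0 ])

    det-T : det₂ T₂ ≈ 1#
    det-T = trans (solve 1 (λ M → con -[1+ 0 ] :* con -[1+ 0 ] :- con (+ 0) :* M := con (+ 1)) refl M) 1-homo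

    shift : Mat₂ → Mat₂
    shift Q = mat₂ (e₁₁ Q + s) (e₁₂ Q) (e₂₁ Q + s * M) (e₂₂ Q + s)
      where s = M * e₁₂ Q - tr₂ Q

    -- W - S_Q in the shape of the definition of a CGC triple, subtraction of zero included, so that
    -- the hypothesis on Q applies as it stands.
    minus-S : Mat₂ → Mat₂ → Mat₂
    minus-S W Q = mat₂ (e₁₁ W - s) (e₁₂ W - 0#) (e₂₁ W - s * M) (e₂₂ W - s)
      where s = M * e₁₂ Q - tr₂ Q

    -- Cayley–Hamilton for T Q, whose trace is s, multiplied by T on the right; shift Q is Q − s T⁻¹.
    T·shift·T : ∀ Q → T₂ ·₂ shift Q ·₂ T₂ ≈₂ neg₂ (inv₂ Q)
    T·shift·T (mat₂ a b c d) =
        solve 5 (λ M a b c d → let s = M :* b :- (a :+ d) in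
          (con -[1+ 0 ] :* (a :+ s) :+ con (+ 0) :* (c :+ s :* M)) :* con -[1+ 0 ] :+ (con -[1+ 0 ] :* b :+ con (+ 0) :* (d :+ s)) :* M
            := :- d) refl M a b c d
      , solve 5 (λ M a b c d → let s = M :* b :- (a :+ d) in
          (con -[1+ 0 ] :* (a :+ s) :+ con (+ 0) :* (c :+ s :* M)) :* con (+ 0) :+ (con -[1+ 0 ] :* b :+ con (+ 0) :* (d :+ s)) :* con -[1+ 0 ]
            := :- (:- b)) refl M a b c d
      , solve 5 (λ M a b c d → let s = M :* b :- (a :+ d) in
          (M :* (a :+ s) :+ con -[1+ 0 ] :* (c :+ s :* M)) :* con -[1+ 0 ] :+ (M :* b :+ con -[1+ 0 ] :* (d :+ s)) :* M
            := :- (:- c)) refl M a b c d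
      , solve 5 (λ M a b c d → let s = M :* b :- (a :+ d) in
          (M :* (a :+ s) :+ con -[1+ 0 ] :* (c :+ s :* M)) :* con (+ 0) :+ (M :* b :+ con -[1+ 0 ] :* (d :+ s)) :* con -[1+ 0 ]
            := :- a) refl M a b c d

    -- As `shift Q` is Q - s T⁻¹ and tr (Q T) = s, the trace is s - 2 s.
    tr-shift : ∀ Q → tr₂ (shift Q ·₂ T₂) ≈ - (M * e₁₂ Q - tr₂ Q)
    tr-shift (mat₂ a b c d) = solve 5 (λ M a b c d → let s = M :* b :- (a :+ d) in
      ((a :+ s) :* con -[1+ 0 ] :+ b :* M) :+ ((c :+ s :* M) :* con (+ 0) :+ (d :+ s) :* con -[1+ 0 ]) := :- s) refl M a b c d

    -- The matrix - T is lower unitriangular. Multiplication by it on the left keeps the first row,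
    -- on the right the second column, and the (1,2) entry lies in both.
    e₁₂-neg-T· : ∀ P → e₁₂ (neg₂ (T₂ ·₂ P)) ≈ e₁₂ P
    e₁₂-neg-T· (mat₂ a b c d) = solve 2 (λ b d → :- (con -[1+ 0 ] :* b :+ con (+ 0) :* d) := b) refl b d

    e₁₂-neg-·T : ∀ P → e₁₂ (neg₂ (P ·₂ T₂)) ≈ e₁₂ P
    e₁₂-neg-·T (mat₂ a b c d) = solve 2 (λ a b → :- (a :* con (+ 0) :+ b :* con -[1+ 0 ]) := b) refl a b

    tr-neg-T· : ∀ P → tr₂ (neg₂ (T₂ ·₂ P)) ≈ tr₂ P - M * e₁₂ P
    tr-neg-T· (mat₂ a b c d) = solve 5 (λ M a b c d →
      (:- (con -[1+ 0 ] :* a :+ con (+ 0) :* c)) :+ (:- (M :* b :+ con -[1+ 0 ] :* d)) := (a :+ d) :- M :* b) refl M a b c d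

    tr-neg-·T : ∀ P → tr₂ (neg₂ (P ·₂ T₂)) ≈ tr₂ P - M * e₁₂ P
    tr-neg-·T (mat₂ a b c d) = solve 5 (λ M a b c d →
      (:- (a :* con -[1+ 0 ] :+ b :* M)) :+ (:- (c :* con (+ 0) :+ d :* con -[1+ 0 ])) := (a :+ d) :- M :* b) refl M a b c d

    middle : Mat₂ → Mat₂ → Mat₂
    middle P R = inv₂ P ·₂ inv₂ T₂ ·₂ inv₂ R

    -- `middle P R` is the adjugate of R T P; taking adjugates preserves the trace, and the trace is
    -- cyclic.
    tr-middle : ∀ P R → tr₂ (middle P R) ≈ tr₂ (P ·₂ R ·₂ T₂)
    tr-middle (mat₂ a b c d) (mat₂ e f g h) = solve 9 (λ M a b c d e f g h →
      ((d :* con -[1+ 0 ] :+ (:- b) :* (:- M)) :* h :+ (d :* (:- con (+ 0)) :+ (:- b) :* con -[1+ 0 ]) :* (:- g))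
      :+ (((:- c) :* con -[1+ 0 ] :+ a :* (:- M)) :* (:- f) :+ ((:- c) :* (:- con (+ 0)) :+ a :* con -[1+ 0 ]) :* e)
      := ((a :* e :+ b :* g) :* con -[1+ 0 ] :+ (a :* f :+ b :* h) :* M)
      :+ ((c :* e :+ d :* g) :* con (+ 0) :+ (c :* f :+ d :* h) :* con -[1+ 0 ])) refl M a b c d e f g h

    -- Sum relation. Substitute tr P - P and tr R - R for the adjugates of P and R, and - I - M E₂₁
    -- for that of T: the part without M contributes the traces and cancels the entry of P R, and
    -- the matrix unit E₂₁ picks out the product of the two (1,2) entries.
    e₁₂-+-middle : ∀ P R → e₁₂ (P ·₂ R) + e₁₂ (middle P R) ≈ e₁₂ R * tr₂ P + e₁₂ P * tr₂ R - M * e₁₂ P * e₁₂ R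
    e₁₂-+-middle (mat₂ a b c d) (mat₂ e f g h) = solve 9 (λ M a b c d e f g h →
      (a :* f :+ b :* h) :+ ((d :* con -[1+ 0 ] :+ (:- b) :* (:- M)) :* (:- f) :+ (d :* (:- con (+ 0)) :+ (:- b) :* con -[1+ 0 ]) :* e)
      := f :* (a :+ d) :+ b :* (e :+ h) :- M :* b :* f) refl M a b c d e f g h

    -- Product relation. With both determinants 1 and the trace equal to - l it becomes the exchange
    -- relation satisfied by the (1,2) entry of the middle factor.
    e₁₂-*-middle : ∀ P R → e₁₂ (P ·₂ R) * e₁₂ (middle P R) ≈
      det₂ R * (e₁₂ P * e₁₂ P) - tr₂ (P ·₂ R ·₂ T₂) * e₁₂ P * e₁₂ R + det₂ P * (e₁₂ R * e₁₂ R)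
    e₁₂-*-middle (mat₂ a b c d) (mat₂ e f g h) = solve 9 (λ M a b c d e f g h →
      (a :* f :+ b :* h) :* ((d :* con -[1+ 0 ] :+ (:- b) :* (:- M)) :* (:- f) :+ (d :* (:- con (+ 0)) :+ (:- b) :* con -[1+ 0 ]) :* e)
      := (e :* h :- f :* g) :* (b :* b)
      :- (((a :* e :+ b :* g) :* con -[1+ 0 ] :+ (a :* f :+ b :* h) :* M)
      :+ ((c :* e :+ d :* g) :* con (+ 0) :+ (c :* f :+ d :* h) :* con -[1+ 0 ])) :* b :* f
      :+ (a :* d :- b :* c) :* (f :* f)) refl M a b c d e f g h

    move-subtrahend : ∀ {x y z} → x ≈ y - z → y ≈ x + z
    move-subtrahend {x} {y} {z} e =
      trans (solve 2 (λ y z → y := (y :- z) :+ z) refl y z) (+-congʳ (sym e))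

    module Decompose (P Q R : Mat₂) (detP : det₂ P ≈ 1#) (detR : det₂ R ≈ 1#)
      (Q≈ : Q ≈₂ minus-S (P ·₂ R) Q)
      {k l n : Carrier} (trP : tr₂ P ≈ M * e₁₂ P - k) (trQ : tr₂ Q ≈ M * e₁₂ Q - l) (trR : tr₂ R ≈ M * e₁₂ R - n)
      where

      private
        a b c y : Carrier
        a = e₁₂ P
        b = e₁₂ Q
        c = e₁₂ R
        y = e₁₂ (middle P R)

      PR≈ : P ·₂ R ≈₂ shift Q
      PR≈ = let (p , q , r , s) = Q≈ in
        move-subtrahend p , trans (move-subtrahend q) (+-identityʳ _) , move-subtrahend r , move-subtrahend s

      X₀ Y₀ Z₀ : Mat₂
      X₀ = neg₂ (T₂ ·₂ P)
      Y₀ = middle P R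
      Z₀ = neg₂ (R ·₂ T₂)

      private
        module F = Factors {T₂} {P} {R} (·-inverseˡ T₂ det-T) (·-inverseʳ T₂ det-T)
          (·-inverseˡ P detP) (·-inverseʳ P detP) (·-inverseˡ R detR)

      product : X₀ ·₂ Y₀ ·₂ Z₀ ≈₂ T₂
      product = F.XYZ

      P-recovered : P ≈₂ neg₂ (inv₂ (Y₀ ·₂ Z₀))
      P-recovered = neg-inv-swap F.YZ

      R-recovered : R ≈₂ neg₂ (inv₂ (X₀ ·₂ Y₀))
      R-recovered = neg-inv-swap F.XY

      Q-recovered : Q ≈₂ neg₂ (inv₂ (X₀ ·₂ Z₀))
      Q-recovered = neg-inv-swap (≈₂-trans F.XZ (≈₂-trans
        (·-cong (·-cong (≈₂-refl {T₂}) PR≈) (≈₂-refl {T₂})) (T·shift·T Q)))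

      unique : ∀ {X' Y' Z'} → X' ·₂ Y' ·₂ Z' ≈₂ T₂ →
        P ≈₂ neg₂ (inv₂ (Y' ·₂ Z')) → R ≈₂ neg₂ (inv₂ (X' ·₂ Y')) → X' ≈₂ X₀ × Y' ≈₂ Y₀ × Z' ≈₂ Z₀
      unique XYZ' P≈ R≈ = X-unique , Y-unique , Z-unique
        where open F.Unique XYZ' P≈ R≈ (·-inverseʳ R detR)

      det-X₀ : det₂ X₀ ≈ 1#
      det-X₀ = trans (det-neg (T₂ ·₂ P)) (det-·-1 T₂ P det-T detP)

      det-Y₀ : det₂ Y₀ ≈ 1#
      det-Y₀ = det-·-1 (inv₂ P ·₂ inv₂ T₂) (inv₂ R)
        (det-·-1 (inv₂ P) (inv₂ T₂) (trans (det-inv P) detP) (trans (det-inv T₂) det-T)) (trans (det-inv R) detR)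

      det-Z₀ : det₂ Z₀ ≈ 1#
      det-Z₀ = trans (det-neg (R ·₂ T₂)) (det-·-1 R T₂ detR det-T)

      e₁₂-X₀ : e₁₂ X₀ ≈ a
      e₁₂-X₀ = e₁₂-neg-T· P

      e₁₂-Z₀ : e₁₂ Z₀ ≈ c
      e₁₂-Z₀ = e₁₂-neg-·T R

      sub-sub : ∀ x y → x - y - x ≈ - y
      sub-sub = solve 2 (λ x y → x :- y :- x := :- y) refl

      tr-X₀ : tr₂ X₀ ≈ - k
      tr-X₀ = trans (tr-neg-T· P) (trans (+-congʳ trP) (sub-sub _ _))

      tr-Z₀ : tr₂ Z₀ ≈ - n
      tr-Z₀ = trans (tr-neg-·T R) (trans (+-congʳ trR) (sub-sub _ _))

      tr-PRT : tr₂ (P ·₂ R ·₂ T₂) ≈ - l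
      tr-PRT = begin
        tr₂ (P ·₂ R ·₂ T₂)      ≈⟨ +-cong (proj₁ PRT≈) (proj₂ (proj₂ (proj₂ PRT≈))) ⟩
        tr₂ (shift Q ·₂ T₂)     ≈⟨ tr-shift Q ⟩
        - (M * b - tr₂ Q)       ≈⟨ -‿cong (+-congˡ (-‿cong trQ)) ⟩
        - (M * b - (M * b - l)) ≈⟨ solve 2 (λ x l → :- (x :- (x :- l)) := :- l) refl (M * b) l ⟩
        - l                     ∎
        where
        open ≈-R
        PRT≈ : P ·₂ R ·₂ T₂ ≈₂ shift Q ·₂ T₂
        PRT≈ = ·-cong PR≈ ≈₂-refl

      tr-Y₀ : tr₂ Y₀ ≈ - l
      tr-Y₀ = trans (tr-middle P R) tr-PRT

      mutation : b * y ≈ a * a + l * a * c + c * c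
      mutation = begin
        b * y                                                          ≈⟨ *-congʳ (proj₁ (proj₂ PR≈)) ⟨
        e₁₂ (P ·₂ R) * y                                               ≈⟨ e₁₂-*-middle P R ⟩
        det₂ R * (a * a) - tr₂ (P ·₂ R ·₂ T₂) * a * c + det₂ P * (c * c)
          ≈⟨ +-cong (+-cong (*-congʳ detR) (-‿cong (*-congʳ (*-congʳ tr-PRT)))) (*-congʳ detP) ⟩
        1# * (a * a) - (- l) * a * c + 1# * (c * c)
          ≈⟨ +-cong (+-congʳ (*-identityˡ _)) (*-identityˡ _) ⟩
        a * a - (- l) * a * c + c * c
          ≈⟨ solve 3 (λ a l c → a :* a :- (:- l) :* a :* c :+ c :* c := a :* a :+ l :* a :* c :+ c :* c) refl a l c ⟩
        a * a + l * a * c + c * c                                      ∎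
        where open ≈-R

      -- Multiply the sum relation by b and replace b y by means of the exchange relation; y then
      -- disappears.
      markov : M * (a * b * c) ≈ a * a + b * b + c * c + k * (b * c) + l * (a * c) + n * (a * b)
      markov = begin
        M * (a * b * c)
          -- The product M a c is written as 2 M a c - M a c, so that M a - k and M c - n appear and
          -- can be exchanged for the traces of P and R.
          ≈⟨ solve 6 (λ M a b c k n → M :* (a :* b :* c) :=
               b :* (c :* (M :* a :- k) :+ a :* (M :* c :- n) :- M :* a :* c) :+ k :* (b :* c) :+ n :* (a :* b)) refl M a b c k n ⟩
        b * (c * (M * a - k) + a * (M * c - n) - M * a * c) + k * (b * c) + n * (a * b)
          ≈⟨ +-congʳ (+-congʳ (*-congˡ (+-congʳ (+-cong (*-congˡ trP) (*-congˡ trR))))) ⟨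
        b * (c * tr₂ P + a * tr₂ R - M * a * c) + k * (b * c) + n * (a * b)
          ≈⟨ +-congʳ (+-congʳ (*-congˡ (e₁₂-+-middle P R))) ⟨
        b * (e₁₂ (P ·₂ R) + y) + k * (b * c) + n * (a * b)
          ≈⟨ +-congʳ (+-congʳ (*-congˡ (+-congʳ (proj₁ (proj₂ PR≈))))) ⟩
        b * (b + y) + k * (b * c) + n * (a * b)
          ≈⟨ +-congʳ (+-congʳ (trans (distribˡ b b y) (+-congˡ mutation))) ⟩
        b * b + (a * a + l * a * c + c * c) + k * (b * c) + n * (a * b)
          ≈⟨ solve 6 (λ a b c k l n → b :* b :+ (a :* a :+ l :* a :* c :+ c :* c) :+ k :* (b :* c) :+ n :* (a :* b)
               := a :* a :+ b :* b :+ c :* c :+ k :* (b :* c) :+ l :* (a :* c) :+ n :* (a :* b)) refl a b c k l n ⟩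
        a * a + b * b + c * c + k * (b * c) + l * (a * c) + n * (a * b) ∎
        where open ≈-R

  -- Markov equation and exchange relation

  MarkovEquation : (M k l n a b c : Carrier) → Set
  MarkovEquation M k l n a b c = M * (a * b * c) ≈ a * a + b * b + c * c + k * (b * c) + l * (a * c) + n * (a * b)

  markov-cong : ∀ {M k l n a b c a' b' c'} → a ≈ a' → b ≈ b' → c ≈ c' →
    MarkovEquation M k l n a b c → MarkovEquation M k l n a' b' c'
  markov-cong p q r e = trans (sym (*-congˡ (*-cong (*-cong p q) r))) (trans e
    (+-cong (+-cong (+-cong (+-cong (+-cong (*-cong p p) (*-cong q q)) (*-cong r r))
      (*-congˡ (*-cong q r))) (*-congˡ (*-cong p r))) (*-congˡ (*-cong p q))))

  -- Each coefficient moves with its variable. Together with `markov-swap₂₃` this generates all six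
  -- orders of a cluster.
  markov-swap₁₂ : ∀ {M k l n a b c} → MarkovEquation M k l n a b c → MarkovEquation M l k n b a c
  markov-swap₁₂ {M} {k} {l} {n} {a} {b} {c} e =
    trans (solve 4 (λ M a b c → M :* (b :* a :* c) := M :* (a :* b :* c)) refl M a b c) (trans e
      (solve 6 (λ k l n a b c → a :* a :+ b :* b :+ c :* c :+ k :* (b :* c) :+ l :* (a :* c) :+ n :* (a :* b)
        := b :* b :+ a :* a :+ c :* c :+ l :* (a :* c) :+ k :* (b :* c) :+ n :* (b :* a)) refl k l n a b c))

  markov-swap₂₃ : ∀ {M k l n a b c} → MarkovEquation M k l n a b c → MarkovEquation M k n l a c b
  markov-swap₂₃ {M} {k} {l} {n} {a} {b} {c} e =
    trans (solve 4 (λ M a b c → M :* (a :* c :* b) := M :* (a :* b :* c)) refl M a b c) (trans e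
      (solve 6 (λ k l n a b c → a :* a :+ b :* b :+ c :* c :+ k :* (b :* c) :+ l :* (a :* c) :+ n :* (a :* b)
        := a :* a :+ c :* c :+ b :* b :+ k :* (c :* b) :+ n :* (a :* b) :+ l :* (a :* c)) refl k l n a b c))

  Exchange : (k b y a c : Carrier) → Set
  Exchange k b y a c = b * y ≈ a * a + k * a * c + c * c

  exchange-cong : ∀ {k b y a c b' a' c'} → b ≈ b' → a ≈ a' → c ≈ c' → Exchange k b y a c → Exchange k b' y a' c'
  exchange-cong q p r e = trans (sym (*-congʳ q)) (trans e
    (+-cong (+-cong (*-cong p p) (*-cong (*-congˡ p) r)) (*-cong r r)))

  exchange-swap : ∀ {k b y a c} → Exchange k b y a c → Exchange k b y c a
  exchange-swap {k} {b} {y} {a} {c} e = trans e (solve 3 (λ k a c →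
    a :* a :+ k :* a :* c :+ c :* c := c :* c :+ k :* c :* a :+ a :* a) refl k a c)

-- The Laurent polynomial ring

open import Defs
open import Algebra.Properties.Semiring.Exp (CommutativeRing.semiring ℚ.+-*-commutativeRing) using (_^_; ^-homo-*)
open ≡ using (_≡_; refl; sym; trans; cong; cong₂; subst; module ≡-Reasoning)

-- Built directly as a reduced fraction whose stored denominator, less one, is 0; injectivity is
-- then that of the constructor.
cast : ℤ → ℚ
cast i = mkℚ i 0 (Coprimality.sym (1-coprimeTo _))

cast-injective : ∀ {i j} → cast i ≡ cast j → i ≡ j
cast-injective = proj₁ ∘ ℚ.mkℚ-injective

cast-+ : ∀ i j → cast (i ℤ.+ j) ≡ cast i ℚ.+ cast j
cast-+ i j = ℚ.toℚᵘ-injective (ℚᵘ.≃-sym (ℚᵘ.≃-trans (ℚ.toℚᵘ-homo-+ (cast i) (cast j))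
  (ℚᵘ.*≡* (cong (ℤ._* + 1) (cong₂ ℤ._+_ (ℤ.*-identityʳ i) (ℤ.*-identityʳ j))))))

cast-* : ∀ i j → cast (i ℤ.* j) ≡ cast i ℚ.* cast j
cast-* i j = ℚ.toℚᵘ-injective (ℚᵘ.≃-sym (ℚ.toℚᵘ-homo-* (cast i) (cast j)))

cast-neg : ∀ i → cast (ℤ.- i) ≡ ℚ.- cast i
cast-neg (+ 0) = refl
cast-neg (ℤ.+[1+ n ]) = refl
cast-neg -[1+ n ] = refl

-- The linear functional with prescribed values on monomials. Coefficients arise from indicator
-- functions, and evaluations at points from multiplicative functions.
∑ : Laurent → (Mono → ℚ) → ℚ
∑ [] f = 0ℚ
∑ ((c , m) ∷ p) f = cast c ℚ.* f m ℚ.+ ∑ p f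

∑-ext : ∀ p {f g} → (∀ m → f m ≡ g m) → ∑ p f ≡ ∑ p g
∑-ext [] f≗g = refl
∑-ext ((c , m) ∷ p) f≗g = cong₂ (λ x s → cast c ℚ.* x ℚ.+ s) (f≗g m) (∑-ext p f≗g)

∑-+ : ∀ p q f → ∑ (p + q) f ≡ ∑ p f ℚ.+ ∑ q f
∑-+ [] q f = sym (ℚ.+-identityˡ _)
∑-+ ((c , m) ∷ p) q f =
  trans (cong (cast c ℚ.* f m ℚ.+_) (∑-+ p q f)) (sym (ℚ.+-assoc (cast c ℚ.* f m) (∑ p f) (∑ q f)))

∑-neg : ∀ p f → ∑ (- p) f ≡ ℚ.- ∑ p f
∑-neg [] f = refl
∑-neg ((c , m) ∷ p) f = begin
  cast (ℤ.- c) ℚ.* f m ℚ.+ ∑ (- p) f       ≡⟨ cong₂ (λ x s → x ℚ.* f m ℚ.+ s) (cast-neg c) (∑-neg p f) ⟩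
  (ℚ.- cast c) ℚ.* f m ℚ.+ (ℚ.- ∑ p f)     ≡⟨ solve 3 (λ x y s → (:- x) :* y :+ (:- s) := :- (x :* y :+ s)) refl (cast c) (f m) (∑ p f) ⟩
  ℚ.- (cast c ℚ.* f m ℚ.+ ∑ p f)           ∎
  where open ≡-Reasoning; open +-*-Solver

∑-zero : ∀ p → ∑ p (const 0ℚ) ≡ 0ℚ
∑-zero [] = refl
∑-zero ((c , m) ∷ p) = cong₂ ℚ._+_ (ℚ.*-zeroʳ (cast c)) (∑-zero p)

∑-linear : ∀ p x f g → ∑ p (λ m → x ℚ.* f m ℚ.+ g m) ≡ x ℚ.* ∑ p f ℚ.+ ∑ p g
∑-linear [] x f g = sym (trans (ℚ.+-identityʳ _) (ℚ.*-zeroʳ x))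
∑-linear ((c , m) ∷ p) x f g =
  trans (cong (cast c ℚ.* (x ℚ.* f m ℚ.+ g m) ℚ.+_) (∑-linear p x f g))
        (solve 6 (λ c x y z s t → c :* (x :* y :+ z) :+ (x :* s :+ t) := x :* (c :* y :+ s) :+ (c :* z :+ t))
           refl (cast c) x (f m) (g m) (∑ p f) (∑ p g))
  where open +-*-Solver

∑-scale : ∀ p x f → ∑ p (λ m → x ℚ.* f m) ≡ x ℚ.* ∑ p f
∑-scale p x f = begin
  ∑ p (λ m → x ℚ.* f m)              ≡⟨ ∑-ext p (λ m → sym (ℚ.+-identityʳ _)) ⟩
  ∑ p (λ m → x ℚ.* f m ℚ.+ 0ℚ)       ≡⟨ ∑-linear p x f (const 0ℚ) ⟩
  x ℚ.* ∑ p f ℚ.+ ∑ p (const 0ℚ)     ≡⟨ cong (x ℚ.* ∑ p f ℚ.+_) (∑-zero p) ⟩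
  x ℚ.* ∑ p f ℚ.+ 0ℚ                 ≡⟨ ℚ.+-identityʳ _ ⟩
  x ℚ.* ∑ p f                        ∎
  where open ≡-Reasoning

∑-swap : ∀ p q (f : Mono → Mono → ℚ) →
  ∑ p (λ m → ∑ q (f m)) ≡ ∑ q (λ n → ∑ p (λ m → f m n))
∑-swap [] q f = sym (∑-zero q)
∑-swap ((c , m) ∷ p) q f =
  trans (cong (cast c ℚ.* ∑ q (f m) ℚ.+_) (∑-swap p q f))
        (sym (∑-linear q (cast c) (f m) (λ n → ∑ p (λ m → f m n))))

-- The function h is described by its values because a pattern-matching lambda written here would
-- not be the one occurring in `_*_`; in `∑-*` that one is found by unification.
∑-map : ∀ c m h → (∀ d n → h (d , n) ≡ (c ℤ.* d , monoMul m n)) → ∀ q f →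
  ∑ (map h q) f ≡ cast c ℚ.* ∑ q (f ∘ monoMul m)
∑-map c m h h≡ [] f = sym (ℚ.*-zeroʳ (cast c))
∑-map c m h h≡ ((d , n) ∷ q) f rewrite h≡ d n =
  trans (cong₂ (λ x s → x ℚ.* f (monoMul m n) ℚ.+ s) (cast-* c d) (∑-map c m h h≡ q f))
        (solve 4 (λ c d y s → (c :* d) :* y :+ c :* s := c :* (d :* y :+ s)) refl (cast c) (cast d) (f (monoMul m n)) (∑ q (f ∘ monoMul m)))
  where open +-*-Solver

∑-* : ∀ p q f → ∑ (p * q) f ≡ ∑ p (λ m → ∑ q (f ∘ monoMul m))
∑-* [] q f = refl
∑-* ((c , m) ∷ p) q f =
  trans (∑-+ (map _ q) (p * q) f) (cong₂ ℚ._+_ (∑-map c m _ (λ _ _ → refl) q f) (∑-* p q f))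

-- Equality of coefficients and equality under all linear functionals

sameMono-refl : ∀ m → sameMono m m ≡ true
sameMono-refl (mono a b c) with a ℤ.≟ a | b ℤ.≟ b | c ℤ.≟ c
... | yes _ | yes _ | yes _ = refl
... | no ¬p | _ | _ = ⊥-elim (¬p refl)
... | yes _ | no ¬p | _ = ⊥-elim (¬p refl)
... | yes _ | yes _ | no ¬p = ⊥-elim (¬p refl)

sameMono⇒≡ : ∀ m n → sameMono m n ≡ true → m ≡ n
sameMono⇒≡ (mono a b c) (mono a' b' c') e with a ℤ.≟ a' | b ℤ.≟ b' | c ℤ.≟ c'
sameMono⇒≡ (mono a b c) (mono a' b' c') e  | yes refl | yes refl | yes refl = refl
sameMono⇒≡ (mono a b c) (mono a' b' c') () | no _ | _ | _
sameMono⇒≡ (mono a b c) (mono a' b' c') () | yes _ | no _ | _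
sameMono⇒≡ (mono a b c) (mono a' b' c') () | yes _ | yes _ | no _

δ : Mono → Mono → ℚ
δ m n = if sameMono n m then 1ℚ else 0ℚ

coeff-∑ : ∀ p m → cast (coeff p m) ≡ ∑ p (δ m)
coeff-∑ [] m = refl
coeff-∑ ((c , n) ∷ p) m with sameMono n m
... | true = trans (cast-+ c (coeff p m)) (cong₂ ℚ._+_ (sym (ℚ.*-identityʳ (cast c))) (coeff-∑ p m))
... | false = trans (coeff-∑ p m)
  (sym (trans (cong (ℚ._+ ∑ p (δ m)) (ℚ.*-zeroʳ (cast c))) (ℚ.+-identityˡ _)))

-- The indicators `δ m` already detect every coefficient. Most ring laws are obtained this way, as
-- identities between sums in which like terms need not be collected.
∑⇒≈ : ∀ p q → (∀ f → ∑ p f ≡ ∑ q f) → p ≈ q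
∑⇒≈ p q eq m = cast-injective (trans (coeff-∑ p m) (trans (eq (δ m)) (sym (coeff-∑ q m))))

remove : Mono → Laurent → Laurent
remove m [] = []
remove m ((c , n) ∷ p) = if sameMono n m then remove m p else (c , n) ∷ remove m p

length-remove : ∀ m p → length (remove m p) ℕ.≤ length p
length-remove m [] = z≤n
length-remove m ((c , n) ∷ p) with sameMono n m
... | true = ℕ.m≤n⇒m≤1+n (length-remove m p)
... | false = s≤s (length-remove m p)

∑-remove : ∀ m p f → ∑ p f ≡ cast (coeff p m) ℚ.* f m ℚ.+ ∑ (remove m p) f
∑-remove m [] f = sym (trans (ℚ.+-identityʳ _) (ℚ.*-zeroˡ (f m)))
∑-remove m ((c , n) ∷ p) f with sameMono n m in eq
... | true rewrite sameMono⇒≡ n m eq | ∑-remove m p f | cast-+ c (coeff p m) =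
  solve 4 (λ c d y s → c :* y :+ (d :* y :+ s) := (c :+ d) :* y :+ s) refl (cast c) (cast (coeff p m)) (f m) (∑ (remove m p) f)
  where open +-*-Solver
... | false rewrite ∑-remove m p f =
  solve 3 (λ u v s → u :+ (v :+ s) := v :+ (u :+ s)) refl (cast c ℚ.* f n) (cast (coeff p m) ℚ.* f m) (∑ (remove m p) f)
  where open +-*-Solver

coeff-remove : ∀ m p n → coeff p n ≡ + 0 → coeff (remove m p) n ≡ + 0
coeff-remove m p n eq with sameMono m n in m≟n
... | true rewrite sameMono⇒≡ m n m≟n = removed p
  where
  removed : ∀ p → coeff (remove n p) n ≡ + 0
  removed [] = refl
  removed ((c , l) ∷ p) with sameMono l n in l≟n
  ... | true = removed p
  ... | false rewrite l≟n = removed p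
... | false = trans (kept p) eq
  where
  kept : ∀ p → coeff (remove m p) n ≡ coeff p n
  kept [] = refl
  kept ((c , l) ∷ p) with sameMono l m in l≟m
  ... | false = cong (λ x → if sameMono l n then c ℤ.+ x else x) (kept p)
  ... | true rewrite sameMono⇒≡ l m l≟m | m≟n = kept p

-- Induction on a bound for the length. The terms carrying the head monomial add up to its total
-- coefficient, which is 0, and the rest is strictly shorter without being a structural tail.
coeff≡0⇒∑≡0 : ∀ k p → length p ℕ.≤ k → (∀ m → coeff p m ≡ + 0) → ∀ f → ∑ p f ≡ 0ℚ
coeff≡0⇒∑≡0 k [] _ _ f = refl
coeff≡0⇒∑≡0 (suc k) p@((c , m) ∷ p') (s≤s len) p≈0 f = begin
  ∑ p f                                             ≡⟨ ∑-remove m p f ⟩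
  cast (coeff p m) ℚ.* f m ℚ.+ ∑ (remove m p) f     ≡⟨ cong₂ (λ x s → cast x ℚ.* f m ℚ.+ s) (p≈0 m)
    (coeff≡0⇒∑≡0 k (remove m p) shorter (λ n → coeff-remove m p n (p≈0 n)) f) ⟩
  0ℚ ℚ.* f m ℚ.+ 0ℚ                                 ≡⟨ trans (ℚ.+-identityʳ _) (ℚ.*-zeroˡ (f m)) ⟩
  0ℚ                                                ∎
  where
  open ≡-Reasoning
  shorter : length (remove m p) ℕ.≤ k
  shorter rewrite sameMono-refl m = ℕ.≤-trans (length-remove m p') len

-- All coefficients of p - q vanish, hence so does the functional on it. Every functional, and so
-- every evaluation, is thereby well defined up to `≈`.
≈⇒∑ : ∀ {p q} → p ≈ q → ∀ f → ∑ p f ≡ ∑ q f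
≈⇒∑ {p} {q} p≈q f = ℚ-difference (trans (sym (trans (∑-+ p (- q) f) (cong (∑ p f ℚ.+_) (∑-neg q f))))
    (coeff≡0⇒∑≡0 _ (p - q) ℕ.≤-refl p-q≈0 f))
  where
  open ≡-Reasoning
  p-q≈0 : ∀ m → coeff (p - q) m ≡ + 0
  p-q≈0 m = cast-injective (begin
    cast (coeff (p - q) m)              ≡⟨ coeff-∑ (p - q) m ⟩
    ∑ (p - q) (δ m)                     ≡⟨ trans (∑-+ p (- q) (δ m)) (cong (∑ p (δ m) ℚ.+_) (∑-neg q (δ m))) ⟩
    ∑ p (δ m) ℚ.- ∑ q (δ m)             ≡⟨ cong₂ ℚ._-_ (sym (coeff-∑ p m)) (sym (coeff-∑ q m)) ⟩
    cast (coeff p m) ℚ.- cast (coeff q m) ≡⟨ cong (λ x → cast x ℚ.- cast (coeff q m)) (p≈q m) ⟩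
    cast (coeff q m) ℚ.- cast (coeff q m) ≡⟨ ℚ.+-inverseʳ (cast (coeff q m)) ⟩
    0ℚ                                  ∎)
  ℚ-difference : ∀ {x y} → x ℚ.- y ≡ 0ℚ → x ≡ y
  ℚ-difference {x} {y} e = trans (solve 2 (λ x y → x := (x :- y) :+ y) refl x y) (trans (cong (ℚ._+ y) e) (ℚ.+-identityˡ y))
    where open +-*-Solver

-- The ring structure up to coefficientwise equality

one : Mono
one = mono (+ 0) (+ 0) (+ 0)

monoMul-comm : ∀ m n → monoMul m n ≡ monoMul n m
monoMul-comm (mono a b c) (mono a' b' c') rewrite ℤ.+-comm a a' | ℤ.+-comm b b' | ℤ.+-comm c c' = refl

monoMul-assoc : ∀ l m n → monoMul (monoMul l m) n ≡ monoMul l (monoMul m n)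
monoMul-assoc (mono a b c) (mono a' b' c') (mono a'' b'' c'')
  rewrite ℤ.+-assoc a a' a'' | ℤ.+-assoc b b' b'' | ℤ.+-assoc c c' c'' = refl

monoMul-identityˡ : ∀ m → monoMul one m ≡ m
monoMul-identityˡ (mono a b c) rewrite ℤ.+-identityˡ a | ℤ.+-identityˡ b | ℤ.+-identityˡ c = refl

∑-cst : ∀ i f → ∑ (cst i) f ≡ cast i ℚ.* f one
∑-cst i f = ℚ.+-identityʳ _

≈-sym : ∀ {p q} → p ≈ q → q ≈ p
≈-sym e m = sym (e m)

≈-trans : ∀ {p q r} → p ≈ q → q ≈ r → p ≈ r
≈-trans e e' m = trans (e m) (e' m)

+-cong : ∀ {p p' q q'} → p ≈ p' → q ≈ q' → p + q ≈ p' + q'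
+-cong {p} {p'} {q} {q'} e e' = ∑⇒≈ (p + q) (p' + q') λ f →
  trans (∑-+ p q f) (trans (cong₂ ℚ._+_ (≈⇒∑ {p} {p'} e f) (≈⇒∑ {q} {q'} e' f)) (sym (∑-+ p' q' f)))

*-cong : ∀ {p p' q q'} → p ≈ p' → q ≈ q' → p * q ≈ p' * q'
*-cong {p} {p'} {q} {q'} e e' = ∑⇒≈ (p * q) (p' * q') λ f → begin
  ∑ (p * q) f                            ≡⟨ ∑-* p q f ⟩
  ∑ p (λ m → ∑ q (f ∘ monoMul m))        ≡⟨ ∑-ext p (λ m → ≈⇒∑ {q} {q'} e' _) ⟩
  ∑ p (λ m → ∑ q' (f ∘ monoMul m))       ≡⟨ ≈⇒∑ {p} {p'} e _ ⟩
  ∑ p' (λ m → ∑ q' (f ∘ monoMul m))      ≡⟨ sym (∑-* p' q' f) ⟩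
  ∑ (p' * q') f                          ∎
  where open ≡-Reasoning

neg-cong : ∀ {p q} → p ≈ q → - p ≈ - q
neg-cong {p} {q} e = ∑⇒≈ (- p) (- q) λ f →
  trans (∑-neg p f) (trans (cong ℚ.-_ (≈⇒∑ {p} {q} e f)) (sym (∑-neg q f)))

+-comm : ∀ p q → p + q ≈ q + p
+-comm p q = ∑⇒≈ (p + q) (q + p) λ f → trans (∑-+ p q f) (trans (ℚ.+-comm (∑ p f) (∑ q f)) (sym (∑-+ q p f)))

+-assoc : ∀ p q r → (p + q) + r ≈ p + (q + r)
+-assoc p q r m = cong (λ s → coeff s m) (++-assoc p q r)

neg-inverseʳ : ∀ p → p - p ≈ zeroL
neg-inverseʳ p = ∑⇒≈ (p - p) zeroL λ f → trans (∑-+ p (- p) f) (trans (cong (∑ p f ℚ.+_) (∑-neg p f)) (ℚ.+-inverseʳ (∑ p f)))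

*-comm : ∀ p q → p * q ≈ q * p
*-comm p q = ∑⇒≈ (p * q) (q * p) λ f → begin
  ∑ (p * q) f                                 ≡⟨ ∑-* p q f ⟩
  ∑ p (λ m → ∑ q (λ n → f (monoMul m n)))     ≡⟨ ∑-swap p q _ ⟩
  ∑ q (λ n → ∑ p (λ m → f (monoMul m n)))     ≡⟨ ∑-ext q (λ n → ∑-ext p (λ m → cong f (monoMul-comm m n))) ⟩
  ∑ q (λ n → ∑ p (λ m → f (monoMul n m)))     ≡⟨ sym (∑-* q p f) ⟩
  ∑ (q * p) f                                 ∎
  where open ≡-Reasoning

*-assoc : ∀ p q r → (p * q) * r ≈ p * (q * r)
*-assoc p q r = ∑⇒≈ ((p * q) * r) (p * (q * r)) λ f → begin
  ∑ ((p * q) * r) f                                                     ≡⟨ ∑-* (p * q) r f ⟩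
  ∑ (p * q) (λ l → ∑ r (f ∘ monoMul l))                                 ≡⟨ ∑-* p q _ ⟩
  ∑ p (λ m → ∑ q (λ n → ∑ r (λ l → f (monoMul (monoMul m n) l))))
    ≡⟨ ∑-ext p (λ m → ∑-ext q (λ n → ∑-ext r (λ l → cong f (monoMul-assoc m n l)))) ⟩
  ∑ p (λ m → ∑ q (λ n → ∑ r (λ l → f (monoMul m (monoMul n l)))))       ≡⟨ ∑-ext p (λ m → sym (∑-* q r _)) ⟩
  ∑ p (λ m → ∑ (q * r) (f ∘ monoMul m))                                 ≡⟨ sym (∑-* p (q * r) f) ⟩
  ∑ (p * (q * r)) f                                                     ∎
  where open ≡-Reasoning

*-identityˡ : ∀ p → cst (+ 1) * p ≈ p
*-identityˡ p = ∑⇒≈ (cst (+ 1) * p) p λ f → begin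
  ∑ (cst (+ 1) * p) f                     ≡⟨ ∑-* (cst (+ 1)) p f ⟩
  1ℚ ℚ.* ∑ p (f ∘ monoMul one) ℚ.+ 0ℚ     ≡⟨ trans (ℚ.+-identityʳ _) (ℚ.*-identityˡ _) ⟩
  ∑ p (f ∘ monoMul one)                   ≡⟨ ∑-ext p (λ m → cong f (monoMul-identityˡ m)) ⟩
  ∑ p f                                   ∎
  where open ≡-Reasoning

*-distribʳ-+ : ∀ p q r → (q + r) * p ≈ q * p + r * p
*-distribʳ-+ p q r = ∑⇒≈ ((q + r) * p) (q * p + r * p) λ f → begin
  ∑ ((q + r) * p) f                                                   ≡⟨ ∑-* (q + r) p f ⟩
  ∑ (q + r) (λ m → ∑ p (f ∘ monoMul m))                               ≡⟨ ∑-+ q r _ ⟩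
  ∑ q (λ m → ∑ p (f ∘ monoMul m)) ℚ.+ ∑ r (λ m → ∑ p (f ∘ monoMul m)) ≡⟨ sym (cong₂ ℚ._+_ (∑-* q p f) (∑-* r p f)) ⟩
  ∑ (q * p) f ℚ.+ ∑ (r * p) f                                         ≡⟨ sym (∑-+ (q * p) (r * p) f) ⟩
  ∑ (q * p + r * p) f                                                 ∎
  where open ≡-Reasoning

laurentRing : CommutativeRing 0ℓ 0ℓ
laurentRing = record
  { Carrier = Laurent ; _≈_ = _≈_ ; _+_ = _+_ ; _*_ = _*_ ; -_ = -_ ; 0# = zeroL ; 1# = cst (+ 1)
  ; isCommutativeRing = record
    { isRing = record
      { +-isAbelianGroup = record
        { isGroup = record
          { isMonoid = record
            { isSemigroup = record
              { isMagma = record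
                { isEquivalence = isEq
                ; ∙-cong = λ {p} {p'} {q} {q'} → +-cong {p} {p'} {q} {q'} }
              ; assoc = +-assoc }
            ; identity = (λ p m → refl) , λ p → ≈-trans {p + zeroL} {zeroL + p} {p} (+-comm p zeroL) (λ m → refl) }
          ; inverse = (λ p → ≈-trans {(- p) + p} {p - p} {zeroL} (+-comm (- p) p) (neg-inverseʳ p)) , neg-inverseʳ
          ; ⁻¹-cong = λ {p} {q} → neg-cong {p} {q} }
        ; comm = +-comm }
      ; *-cong = λ {p} {p'} {q} {q'} → *-cong {p} {p'} {q} {q'}
      ; *-assoc = *-assoc
      ; *-identity = *-identityˡ , λ p → ≈-trans {p * cst (+ 1)} {cst (+ 1) * p} {p} (*-comm p (cst (+ 1))) (*-identityˡ p)
      ; distrib = (λ p q r → ≈-trans {p * (q + r)} {(q + r) * p} {p * q + p * r} (*-comm p (q + r))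
                     (≈-trans {(q + r) * p} {q * p + r * p} {p * q + p * r} (*-distribʳ-+ p q r)
                        (+-cong {q * p} {p * q} {r * p} {p * r} (*-comm q p) (*-comm r p))))
                , *-distribʳ-+ }
    ; *-comm = *-comm } }
  where
  isEq : IsEquivalence _≈_
  isEq = record { refl = λ m → refl ; sym = λ e m → sym (e m) ; trans = λ {p} {q} {r} → ≈-trans {p} {q} {r} }

cst-+ : ∀ i j → cst (i ℤ.+ j) ≈ cst i + cst j
cst-+ i j = ∑⇒≈ (cst (i ℤ.+ j)) (cst i + cst j) λ f → begin
  ∑ (cst (i ℤ.+ j)) f                       ≡⟨ ∑-cst (i ℤ.+ j) f ⟩
  cast (i ℤ.+ j) ℚ.* f one                  ≡⟨ cong (ℚ._* f one) (cast-+ i j) ⟩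
  (cast i ℚ.+ cast j) ℚ.* f one             ≡⟨ ℚ.*-distribʳ-+ (f one) (cast i) (cast j) ⟩
  cast i ℚ.* f one ℚ.+ cast j ℚ.* f one     ≡⟨ cong (cast i ℚ.* f one ℚ.+_) (∑-cst j f) ⟨
  ∑ (cst i + cst j) f                       ∎
  where open ≡-Reasoning

cst-0 : cst (+ 0) ≈ zeroL
cst-0 = ∑⇒≈ (cst (+ 0)) zeroL λ f → trans (∑-cst (+ 0) f) (ℚ.*-zeroˡ (f one))

cst-hom : ℤ.+-*-rawRing -Raw-AlmostCommutative⟶ fromCommutativeRing laurentRing
cst-hom = record
  { ⟦_⟧ = cst ; +-homo = cst-+ ; *-homo = λ i j m → refl ; -‿homo = λ i m → refl
  ; 0-homo = cst-0 ; 1-homo = λ m → refl }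

-- Evaluation of clusters at positive rational points

-- A monoid homomorphism from the monomials to ℚ; its linear extension is a ring homomorphism on
-- Laurent polynomials.
record IsCharacter (f : Mono → ℚ) : Set where
  field
    f-one : f one ≡ 1ℚ
    f-mul : ∀ m n → f (monoMul m n) ≡ f m ℚ.* f n

module Evaluation {f : Mono → ℚ} (isCharacter : IsCharacter f) where
  open IsCharacter isCharacter

  ev : Laurent → ℚ
  ev p = ∑ p f

  ev-* : ∀ p q → ev (p * q) ≡ ev p ℚ.* ev q
  ev-* p q = begin
    ∑ (p * q) f                              ≡⟨ ∑-* p q f ⟩
    ∑ p (λ m → ∑ q (λ n → f (monoMul m n)))  ≡⟨ ∑-ext p (λ m → ∑-ext q (f-mul m)) ⟩
    ∑ p (λ m → ∑ q (λ n → f m ℚ.* f n))      ≡⟨ ∑-ext p (λ m → trans (∑-scale q (f m) f) (ℚ.*-comm (f m) (ev q))) ⟩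
    ∑ p (λ m → ev q ℚ.* f m)                 ≡⟨ ∑-scale p (ev q) f ⟩
    ev q ℚ.* ev p                            ≡⟨ ℚ.*-comm (ev q) (ev p) ⟩
    ev p ℚ.* ev q                            ∎
    where open ≡-Reasoning

  ev-+ : ∀ p q → ev (p + q) ≡ ev p ℚ.+ ev q
  ev-+ p q = ∑-+ p q f

  ev-κ : ∀ k → ev (κ k) ≡ cast (+ k)
  ev-κ k = trans (∑-cst (+ k) f) (trans (cong (cast (+ k) ℚ.*_) f-one) (ℚ.*-identityʳ (cast (+ k))))

  ev-+≡ : ∀ p q {x y} → ev p ≡ x → ev q ≡ y → ev (p + q) ≡ x ℚ.+ y
  ev-+≡ p q e e' = trans (ev-+ p q) (cong₂ ℚ._+_ e e')

  ev-*≡ : ∀ p q {x y} → ev p ≡ x → ev q ≡ y → ev (p * q) ≡ x ℚ.* y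
  ev-*≡ p q e e' = trans (ev-* p q) (cong₂ ℚ._*_ e e')

  ev-numerator : ∀ k b c {v w} → ev b ≡ v → ev c ≡ w →
    ev (b * b + κ k * b * c + c * c) ≡ v ℚ.* v ℚ.+ cast (+ k) ℚ.* v ℚ.* w ℚ.+ w ℚ.* w
  ev-numerator k b c eb ec =
    ev-+≡ (b * b + κ k * b * c) (c * c)
      (ev-+≡ (b * b) (κ k * b * c) (ev-*≡ b b eb eb) (ev-*≡ (κ k * b) c (ev-*≡ (κ k) b (ev-κ k) eb) ec))
      (ev-*≡ c c ec ec)

module _ (u u⁻¹ : ℚ) where

  -- Integer powers of u, with the inverse passed as a separate number so that the definition needs
  -- no proof that u is nonzero.
  zpow : ℤ → ℚ
  zpow (+ n) = u ^ n
  zpow -[1+ n ] = u⁻¹ ^ suc n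

  module _ (uu⁻¹≡1 : u ℚ.* u⁻¹ ≡ 1ℚ) where

    -- A common successor in m and n corresponds to a factor u u⁻¹ = 1 on the right. This settles
    -- the cases of mixed sign in `zpow-+`.
    zpow-⊖ : ∀ m n → zpow (m ℤ.⊖ n) ≡ u ^ m ℚ.* u⁻¹ ^ n
    zpow-⊖ zero zero = refl
    zpow-⊖ zero (suc n) = sym (ℚ.*-identityˡ _)
    zpow-⊖ (suc m) zero = sym (ℚ.*-identityʳ _)
    zpow-⊖ (suc m) (suc n) = begin
      zpow (suc m ℤ.⊖ suc n)                      ≡⟨ cong zpow (ℤ.[1+m]⊖[1+n]≡m⊖n m n) ⟩
      zpow (m ℤ.⊖ n)                              ≡⟨ zpow-⊖ m n ⟩
      u ^ m ℚ.* u⁻¹ ^ n                           ≡⟨ ℚ.*-identityˡ _ ⟨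
      1ℚ ℚ.* (u ^ m ℚ.* u⁻¹ ^ n)                  ≡⟨ cong (ℚ._* (u ^ m ℚ.* u⁻¹ ^ n)) uu⁻¹≡1 ⟨
      (u ℚ.* u⁻¹) ℚ.* (u ^ m ℚ.* u⁻¹ ^ n)         ≡⟨ solve 4 (λ a b c d → (a :* b) :* (c :* d) := (a :* c) :* (b :* d)) refl u u⁻¹ (u ^ m) (u⁻¹ ^ n) ⟩
      (u ℚ.* u ^ m) ℚ.* (u⁻¹ ℚ.* u⁻¹ ^ n)         ∎
      where open ≡-Reasoning; open +-*-Solver

    zpow-+ : ∀ i j → zpow (i ℤ.+ j) ≡ zpow i ℚ.* zpow j
    zpow-+ (+ m) (+ n) = ^-homo-* u m n
    zpow-+ (+ m) -[1+ n ] = zpow-⊖ m (suc n)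
    zpow-+ -[1+ m ] (+ n) = trans (zpow-⊖ n (suc m)) (ℚ.*-comm (u ^ n) (u⁻¹ ^ suc m))
    zpow-+ -[1+ m ] -[1+ n ] = trans (cong (u⁻¹ ^_) (sym (ℕ.+-suc (suc m) n))) (^-homo-* u⁻¹ (suc m) (suc n))

reciprocal : ∀ u → Positive u → ∃[ u⁻¹ ] (Positive u⁻¹ × u ℚ.* u⁻¹ ≡ 1ℚ)
reciprocal u u>0 = (1/ u) {{u≢0}} , ℚ.1/pos⇒pos u {{u>0}} , ℚ.*-inverseʳ u {{u≢0}}
  where
  u≢0 : ℚ.NonZero u
  u≢0 = ℚ.pos⇒nonZero u {{u>0}}

cancelˡ : ∀ u → Positive u → ∀ {x y} → u ℚ.* x ≡ u ℚ.* y → x ≡ y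
cancelˡ u u>0 {x} {y} e with reciprocal u u>0
... | ū , _ , uū≡1 = trans (expand x) (trans (cong (ū ℚ.*_) e) (sym (expand y)))
  where
  expand : ∀ z → z ≡ ū ℚ.* (u ℚ.* z)
  expand z = sym (trans (sym (ℚ.*-assoc ū u z)) (trans (cong (ℚ._* z) (trans (ℚ.*-comm ū u) uū≡1)) (ℚ.*-identityˡ z)))

-- u and u' are the two roots of the Markov equation, a quadratic with constant term n; at u' it is
-- u' times the relation for the sum of the roots.
vieta : ∀ M u u' v w n β γ → Positive u' → u' ℚ.* u ≡ n →
  M ℚ.* (u' ℚ.* (v ℚ.* w)) ≡ u' ℚ.* u' ℚ.+ n ℚ.+ β ℚ.* u' ℚ.+ γ ℚ.* u' →
  M ℚ.* (u ℚ.* (v ℚ.* w)) ≡ u ℚ.* u ℚ.+ n ℚ.+ β ℚ.* u ℚ.+ γ ℚ.* u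
vieta M u u' v w _ β γ u'>0 refl e = begin
  M ℚ.* (u ℚ.* (v ℚ.* w))                  ≡⟨ solve 3 (λ M u p → M :* (u :* p) := u :* (M :* p)) refl M u (v ℚ.* w) ⟩
  u ℚ.* (M ℚ.* (v ℚ.* w))                  ≡⟨ cong (u ℚ.*_) root-sum ⟩
  u ℚ.* (u' ℚ.+ u ℚ.+ β ℚ.+ γ)             ≡⟨ solve 4 (λ u u' β γ → u :* (u' :+ u :+ β :+ γ) := u :* u :+ u' :* u :+ β :* u :+ γ :* u) refl u u' β γ ⟩
  u ℚ.* u ℚ.+ u' ℚ.* u ℚ.+ β ℚ.* u ℚ.+ γ ℚ.* u ∎
  where
  open ≡-Reasoning
  open +-*-Solver
  root-sum : M ℚ.* (v ℚ.* w) ≡ u' ℚ.+ u ℚ.+ β ℚ.+ γ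
  root-sum = cancelˡ u' u'>0 (begin
    u' ℚ.* (M ℚ.* (v ℚ.* w))                       ≡⟨ solve 3 (λ M u p → u :* (M :* p) := M :* (u :* p)) refl M u' (v ℚ.* w) ⟩
    M ℚ.* (u' ℚ.* (v ℚ.* w))                       ≡⟨ e ⟩
    u' ℚ.* u' ℚ.+ u' ℚ.* u ℚ.+ β ℚ.* u' ℚ.+ γ ℚ.* u' ≡⟨ solve 4 (λ u u' β γ → u' :* (u' :+ u :+ β :+ γ) := u' :* u' :+ u' :* u :+ β :* u' :+ γ :* u') refl u u' β γ ⟨
    u' ℚ.* (u' ℚ.+ u ℚ.+ β ℚ.+ γ)                  ∎)

-- The square of w is positive and the other summands are nonnegative. Undoing a mutation therefore
-- stays within the positive rationals.
numerator-pos : ∀ k v w → Positive v → Positive w → Positive (v ℚ.* v ℚ.+ cast (+ k) ℚ.* v ℚ.* w ℚ.+ w ℚ.* w)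
numerator-pos k v w v>0 w>0 =
  ℚ.nonNeg+pos⇒pos (v ℚ.* v ℚ.+ cast (+ k) ℚ.* v ℚ.* w) {{s≥0}} (w ℚ.* w) {{ℚ.pos*pos⇒pos w {{w>0}} w {{w>0}}}}
  where
  v≥0 : NonNegative v
  v≥0 = ℚ.pos⇒nonNeg v {{v>0}}
  kv≥0 : NonNegative (cast (+ k) ℚ.* v)
  kv≥0 = ℚ.nonNeg*nonNeg⇒nonNeg (cast (+ k)) v {{v≥0}}
  s≥0 : NonNegative (v ℚ.* v ℚ.+ cast (+ k) ℚ.* v ℚ.* w)
  s≥0 = ℚ.nonNeg+nonNeg⇒nonNeg (v ℚ.* v) {{ℚ.nonNeg*nonNeg⇒nonNeg v {{v≥0}} v {{v≥0}}}}
    (cast (+ k) ℚ.* v ℚ.* w) {{ℚ.nonNeg*nonNeg⇒nonNeg (cast (+ k) ℚ.* v) {{kv≥0}} w {{ℚ.pos⇒nonNeg w {{w>0}}}}}}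

quotient : ∀ n u → Positive n → Positive u → ∃[ u' ] (Positive u' × u' ℚ.* u ≡ n)
quotient n u n>0 u>0 with reciprocal u u>0
... | ū , ū>0 , uū≡1 = n ℚ.* ū , ℚ.pos*pos⇒pos n {{n>0}} ū {{ū>0}} ,
  trans (ℚ.*-assoc n ū u) (trans (cong (n ℚ.*_) (trans (ℚ.*-comm ū u) uū≡1)) (ℚ.*-identityʳ n))

module _ (k₁ k₂ k₃ : ℕ) where

  private
    κ₁ κ₂ κ₃ : ℚ
    κ₁ = cast (+ k₁)
    κ₂ = cast (+ k₂)
    κ₃ = cast (+ k₃)

  markov : ℚ → ℚ → ℚ → ℚ
  markov u v w = u ℚ.* u ℚ.+ v ℚ.* v ℚ.+ w ℚ.* w ℚ.+ κ₁ ℚ.* (v ℚ.* w) ℚ.+ κ₂ ℚ.* (u ℚ.* w) ℚ.+ κ₃ ℚ.* (u ℚ.* v)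

  -- A homomorphism to ℚ at which the cluster takes prescribed values. The Markov equation at these
  -- values is carried along, since each mutation step derives it from the previous one.
  record Realization (a b c : Laurent) (u v w : ℚ) : Set where
    constructor realization
    field
      {f} : Mono → ℚ
      isCharacter : IsCharacter f
    open Evaluation isCharacter using (ev)
    field
      ev-a : ev a ≡ u
      ev-b : ev b ≡ v
      ev-c : ev c ≡ w
      ev-𝓜 : ev (𝓜 k₁ k₂ k₃) ℚ.* (u ℚ.* v ℚ.* w) ≡ markov u v w

  -- Induction on the mutations, read backwards: for the new variable to have the value u, the old
  -- one must have the value N / u, with N the exchange numerator. This is positive, so the
  -- induction hypothesis applies there.
  realize : ∀ {a b c} → Labeled k₁ k₂ k₃ a b c → ∀ u v w → Positive u → Positive v → Positive w →
    Realization a b c u v w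
  realize {a} {b} {c} (base a≈ b≈ c≈) u v w u>0 v>0 w>0
    with reciprocal u u>0 | reciprocal v v>0 | reciprocal w w>0
  ... | ū , _ , uū≡1 | v̄ , _ , vv̄≡1 | w̄ , _ , ww̄≡1 =
    realization isChar (trans (≈⇒∑ {a} {x₁} a≈ f) ev-x₁) (trans (≈⇒∑ {b} {x₂} b≈ f) ev-x₂) (trans (≈⇒∑ {c} {x₃} c≈ f) ev-x₃) ev-M
    where
    open ≡-Reasoning
    open +-*-Solver
    f : Mono → ℚ
    f (mono i j l) = zpow u ū i ℚ.* zpow v v̄ j ℚ.* zpow w w̄ l
    isChar : IsCharacter f
    isChar = record
      { f-one = refl
      ; f-mul = λ (mono i j l) (mono i' j' l') →
          trans (cong₂ ℚ._*_ (cong₂ ℚ._*_ (zpow-+ u ū uū≡1 i i') (zpow-+ v v̄ vv̄≡1 j j')) (zpow-+ w w̄ ww̄≡1 l l'))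
                (solve 6 (λ x x' y y' z z' → (x :* x') :* (y :* y') :* (z :* z') := (x :* y :* z) :* (x' :* y' :* z')) refl
                   (zpow u ū i) (zpow u ū i') (zpow v v̄ j) (zpow v v̄ j') (zpow w w̄ l) (zpow w w̄ l')) }
    open Evaluation isChar
    ev-x₁ : ev x₁ ≡ u
    -- The left side is the unfolded sum: coefficient 1, the power u ^ 1, two powers with exponent
    -- 0, and the empty sum.
    ev-x₁ = solve 1 (λ u → con 1ℚ :* (u :* con 1ℚ :* con 1ℚ :* con 1ℚ) :+ con 0ℚ := u) refl u
    ev-x₂ : ev x₂ ≡ v
    ev-x₂ = solve 1 (λ v → con 1ℚ :* (con 1ℚ :* (v :* con 1ℚ) :* con 1ℚ) :+ con 0ℚ := v) refl v
    ev-x₃ : ev x₃ ≡ w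
    ev-x₃ = solve 1 (λ w → con 1ℚ :* (con 1ℚ :* con 1ℚ :* (w :* con 1ℚ)) :+ con 0ℚ := w) refl w
    ev-x123⁻¹ : ev x123⁻¹ ≡ ū ℚ.* v̄ ℚ.* w̄
    ev-x123⁻¹ = solve 3 (λ ū v̄ w̄ → con 1ℚ :* ((ū :* con 1ℚ) :* (v̄ :* con 1ℚ) :* (w̄ :* con 1ℚ)) :+ con 0ℚ := ū :* v̄ :* w̄) refl ū v̄ w̄
    ev-product : ∀ k p q {x y} → ev p ≡ x → ev q ≡ y → ev (κ k * p * q) ≡ cast (+ k) ℚ.* (x ℚ.* y)
    ev-product k p q {x} {y} e e' = trans (ev-*≡ (κ k * p) q (ev-*≡ (κ k) p (ev-κ k) e) e') (ℚ.*-assoc (cast (+ k)) x y)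
    N : Laurent
    N = x₁ * x₁ + x₂ * x₂ + x₃ * x₃ + κ k₁ * x₂ * x₃ + κ k₂ * x₁ * x₃ + κ k₃ * x₁ * x₂
    ev-N : ev N ≡ markov u v w
    ev-N =
      ev-+≡ (x₁ * x₁ + x₂ * x₂ + x₃ * x₃ + κ k₁ * x₂ * x₃ + κ k₂ * x₁ * x₃) (κ k₃ * x₁ * x₂)
        (ev-+≡ (x₁ * x₁ + x₂ * x₂ + x₃ * x₃ + κ k₁ * x₂ * x₃) (κ k₂ * x₁ * x₃)
          (ev-+≡ (x₁ * x₁ + x₂ * x₂ + x₃ * x₃) (κ k₁ * x₂ * x₃)
            (ev-+≡ (x₁ * x₁ + x₂ * x₂) (x₃ * x₃)
              (ev-+≡ (x₁ * x₁) (x₂ * x₂) (ev-*≡ x₁ x₁ ev-x₁ ev-x₁) (ev-*≡ x₂ x₂ ev-x₂ ev-x₂))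
              (ev-*≡ x₃ x₃ ev-x₃ ev-x₃))
            (ev-product k₁ x₂ x₃ ev-x₂ ev-x₃))
          (ev-product k₂ x₁ x₃ ev-x₁ ev-x₃))
        (ev-product k₃ x₁ x₂ ev-x₁ ev-x₂)
    ev-M : ev (𝓜 k₁ k₂ k₃) ℚ.* (u ℚ.* v ℚ.* w) ≡ markov u v w
    ev-M = begin
      ev (𝓜 k₁ k₂ k₃) ℚ.* (u ℚ.* v ℚ.* w)                    ≡⟨ cong (ℚ._* (u ℚ.* v ℚ.* w)) (ev-*≡ N x123⁻¹ ev-N ev-x123⁻¹) ⟩
      markov u v w ℚ.* (ū ℚ.* v̄ ℚ.* w̄) ℚ.* (u ℚ.* v ℚ.* w)
        ≡⟨ solve 7 (λ N ū v̄ w̄ u v w → N :* (ū :* v̄ :* w̄) :* (u :* v :* w) := N :* ((u :* ū) :* (v :* v̄) :* (w :* w̄))) refl (markov u v w) ū v̄ w̄ u v w ⟩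
      markov u v w ℚ.* ((u ℚ.* ū) ℚ.* (v ℚ.* v̄) ℚ.* (w ℚ.* w̄)) ≡⟨ cong (markov u v w ℚ.*_) (cong₂ ℚ._*_ (cong₂ ℚ._*_ uū≡1 vv̄≡1) ww̄≡1) ⟩
      markov u v w ℚ.* 1ℚ                                     ≡⟨ ℚ.*-identityʳ _ ⟩
      markov u v w                                            ∎
  realize {a'} {b} {c} (mut₁ {a = a} L rel) u v w u>0 v>0 w>0
    with quotient (v ℚ.* v ℚ.+ κ₁ ℚ.* v ℚ.* w ℚ.+ w ℚ.* w) u (numerator-pos k₁ v w v>0 w>0) u>0
  -- The cluster before the mutation is realized at (u', v, w), and the same homomorphism serves
  -- after it.
  ... | u' , u'>0 , u'u≡N with realize L u' v w u'>0 v>0 w>0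
  ... | realization {f} isChar ev-a ev-b ev-c ev-𝓜 = realization isChar ev-a' ev-b ev-c
      (trans (cong (M ℚ.*_) (solve 3 (λ x y z → x :* y :* z := x :* (y :* z)) refl u v w))
        (trans (vieta M u u' v w _ (κ₂ ℚ.* w) (κ₃ ℚ.* v) u'>0 u'u≡N
           (trans (cong (M ℚ.*_) (solve 3 (λ x y z → x :* (y :* z) := x :* y :* z) refl u' v w)) (trans ev-𝓜 (collect u'))))
          (sym (collect u))))
    where
    open Evaluation isChar using (ev; ev-*; ev-numerator)
    open +-*-Solver
    M : ℚ
    M = ev (𝓜 k₁ k₂ k₃)
    ev-a' : ev a' ≡ u
    -- The exchange relation evaluates to u' times the value of a' being N, which is also u' u.
    ev-a' = cancelˡ u' u'>0 (begin
      u' ℚ.* ev a'   ≡⟨ cong (ℚ._* ev a') ev-a ⟨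
      ev a ℚ.* ev a' ≡⟨ ev-* a a' ⟨
      ev (a * a')    ≡⟨ ≈⇒∑ {a * a'} {b * b + κ k₁ * b * c + c * c} rel f ⟩
      ev (b * b + κ k₁ * b * c + c * c) ≡⟨ ev-numerator k₁ b c ev-b ev-c ⟩
      _              ≡⟨ u'u≡N ⟨
      u' ℚ.* u       ∎)
      where open ≡-Reasoning
    -- As a quadratic in the mutated variable, the Markov polynomial has the exchange numerator as
    -- its constant term, so mutation passes to the other root.
    collect : ∀ x → markov x v w ≡ x ℚ.* x ℚ.+ (v ℚ.* v ℚ.+ κ₁ ℚ.* v ℚ.* w ℚ.+ w ℚ.* w) ℚ.+ κ₂ ℚ.* w ℚ.* x ℚ.+ κ₃ ℚ.* v ℚ.* x
    collect x = solve 6 (λ x v w k₁ k₂ k₃ →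
      x :* x :+ v :* v :+ w :* w :+ k₁ :* (v :* w) :+ k₂ :* (x :* w) :+ k₃ :* (x :* v)
      := x :* x :+ (v :* v :+ k₁ :* v :* w :+ w :* w) :+ k₂ :* w :* x :+ k₃ :* v :* x) refl x v w κ₁ κ₂ κ₃
  realize {a} {b'} {c} (mut₂ {b = b} L rel) u v w u>0 v>0 w>0
    with quotient (u ℚ.* u ℚ.+ κ₂ ℚ.* u ℚ.* w ℚ.+ w ℚ.* w) v (numerator-pos k₂ u w u>0 w>0) v>0
  ... | v' , v'>0 , v'v≡N with realize L u v' w u>0 v'>0 w>0
  ... | realization {f} isChar ev-a ev-b ev-c ev-𝓜 = realization isChar ev-a ev-b' ev-c
      (trans (cong (M ℚ.*_) (solve 3 (λ x y z → x :* y :* z := y :* (x :* z)) refl u v w))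
        (trans (vieta M v v' u w _ (κ₁ ℚ.* w) (κ₃ ℚ.* u) v'>0 v'v≡N
           (trans (cong (M ℚ.*_) (solve 3 (λ x y z → y :* (x :* z) := x :* y :* z) refl u v' w)) (trans ev-𝓜 (collect v'))))
          (sym (collect v))))
    where
    open Evaluation isChar using (ev; ev-*; ev-numerator)
    open +-*-Solver
    M : ℚ
    M = ev (𝓜 k₁ k₂ k₃)
    ev-b' : ev b' ≡ v
    ev-b' = cancelˡ v' v'>0 (begin
      v' ℚ.* ev b'   ≡⟨ cong (ℚ._* ev b') ev-b ⟨
      ev b ℚ.* ev b' ≡⟨ ev-* b b' ⟨
      ev (b * b')    ≡⟨ ≈⇒∑ {b * b'} {a * a + κ k₂ * a * c + c * c} rel f ⟩
      ev (a * a + κ k₂ * a * c + c * c) ≡⟨ ev-numerator k₂ a c ev-a ev-c ⟩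
      _              ≡⟨ v'v≡N ⟨
      v' ℚ.* v       ∎)
      where open ≡-Reasoning
    collect : ∀ y → markov u y w ≡ y ℚ.* y ℚ.+ (u ℚ.* u ℚ.+ κ₂ ℚ.* u ℚ.* w ℚ.+ w ℚ.* w) ℚ.+ κ₁ ℚ.* w ℚ.* y ℚ.+ κ₃ ℚ.* u ℚ.* y
    collect y = solve 6 (λ u y w k₁ k₂ k₃ →
      u :* u :+ y :* y :+ w :* w :+ k₁ :* (y :* w) :+ k₂ :* (u :* w) :+ k₃ :* (u :* y)
      := y :* y :+ (u :* u :+ k₂ :* u :* w :+ w :* w) :+ k₁ :* w :* y :+ k₃ :* u :* y) refl u y w κ₁ κ₂ κ₃
  realize {a} {b} {c'} (mut₃ {c = c} L rel) u v w u>0 v>0 w>0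
    with quotient (u ℚ.* u ℚ.+ κ₃ ℚ.* u ℚ.* v ℚ.+ v ℚ.* v) w (numerator-pos k₃ u v u>0 v>0) w>0
  ... | w' , w'>0 , w'w≡N with realize L u v w' u>0 v>0 w'>0
  ... | realization {f} isChar ev-a ev-b ev-c ev-𝓜 = realization isChar ev-a ev-b ev-c'
      (trans (cong (M ℚ.*_) (solve 3 (λ x y z → x :* y :* z := z :* (x :* y)) refl u v w))
        (trans (vieta M w w' u v _ (κ₁ ℚ.* v) (κ₂ ℚ.* u) w'>0 w'w≡N
           (trans (cong (M ℚ.*_) (solve 3 (λ x y z → z :* (x :* y) := x :* y :* z) refl u v w')) (trans ev-𝓜 (collect w'))))
          (sym (collect w))))
    where
    open Evaluation isChar using (ev; ev-*; ev-numerator)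
    open +-*-Solver
    M : ℚ
    M = ev (𝓜 k₁ k₂ k₃)
    ev-c' : ev c' ≡ w
    ev-c' = cancelˡ w' w'>0 (begin
      w' ℚ.* ev c'   ≡⟨ cong (ℚ._* ev c') ev-c ⟨
      ev c ℚ.* ev c' ≡⟨ ev-* c c' ⟨
      ev (c * c')    ≡⟨ ≈⇒∑ {c * c'} {a * a + κ k₃ * a * b + b * b} rel f ⟩
      ev (a * a + κ k₃ * a * b + b * b) ≡⟨ ev-numerator k₃ a b ev-a ev-b ⟩
      _              ≡⟨ w'w≡N ⟨
      w' ℚ.* w       ∎)
      where open ≡-Reasoning
    collect : ∀ z → markov u v z ≡ z ℚ.* z ℚ.+ (u ℚ.* u ℚ.+ κ₃ ℚ.* u ℚ.* v ℚ.+ v ℚ.* v) ℚ.+ κ₁ ℚ.* v ℚ.* z ℚ.+ κ₂ ℚ.* u ℚ.* z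
    collect z = solve 6 (λ u v z k₁ k₂ k₃ →
      u :* u :+ v :* v :+ z :* z :+ k₁ :* (v :* z) :+ k₂ :* (u :* z) :+ k₃ :* (u :* v)
      := z :* z :+ (u :* u :+ k₃ :* u :* v :+ v :* v) :+ k₁ :* v :* z :+ k₂ :* u :* z) refl u v z κ₁ κ₂ κ₃

-- Recovering the parities from the Markov equation

module ML = Matrices laurentRing cst-hom

private
  2ℚ : ℚ
  2ℚ = 1ℚ ℚ.+ 1ℚ

-- Doubling the first coordinate doubles every mixed term except that of k₁, and the squares cancel
-- because 2 · 3 = 4 + 1 + 1. The next two lemmas double the other coordinates.
k₁-from-markov : ∀ k₁ k₂ k₃ →
  cast (+ k₁) ≡ 2ℚ ℚ.* markov k₁ k₂ k₃ 1ℚ 1ℚ 1ℚ ℚ.- markov k₁ k₂ k₃ 2ℚ 1ℚ 1ℚ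
k₁-from-markov k₁ k₂ k₃ = solve 3 (λ k l n → k := con 2ℚ :*
    (con 1ℚ :* con 1ℚ :+ con 1ℚ :* con 1ℚ :+ con 1ℚ :* con 1ℚ :+ k :* (con 1ℚ :* con 1ℚ) :+ l :* (con 1ℚ :* con 1ℚ) :+ n :* (con 1ℚ :* con 1ℚ))
    :- (con 2ℚ :* con 2ℚ :+ con 1ℚ :* con 1ℚ :+ con 1ℚ :* con 1ℚ :+ k :* (con 1ℚ :* con 1ℚ) :+ l :* (con 2ℚ :* con 1ℚ) :+ n :* (con 2ℚ :* con 1ℚ)))
    refl (cast (+ k₁)) (cast (+ k₂)) (cast (+ k₃))
  where open +-*-Solver

k₂-from-markov : ∀ k₁ k₂ k₃ →
  cast (+ k₂) ≡ 2ℚ ℚ.* markov k₁ k₂ k₃ 1ℚ 1ℚ 1ℚ ℚ.- markov k₁ k₂ k₃ 1ℚ 2ℚ 1ℚ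
k₂-from-markov k₁ k₂ k₃ = solve 3 (λ k l n → l := con 2ℚ :*
    (con 1ℚ :* con 1ℚ :+ con 1ℚ :* con 1ℚ :+ con 1ℚ :* con 1ℚ :+ k :* (con 1ℚ :* con 1ℚ) :+ l :* (con 1ℚ :* con 1ℚ) :+ n :* (con 1ℚ :* con 1ℚ))
    :- (con 1ℚ :* con 1ℚ :+ con 2ℚ :* con 2ℚ :+ con 1ℚ :* con 1ℚ :+ k :* (con 2ℚ :* con 1ℚ) :+ l :* (con 1ℚ :* con 1ℚ) :+ n :* (con 1ℚ :* con 2ℚ)))
    refl (cast (+ k₁)) (cast (+ k₂)) (cast (+ k₃))
  where open +-*-Solver

k₃-from-markov : ∀ k₁ k₂ k₃ →
  cast (+ k₃) ≡ 2ℚ ℚ.* markov k₁ k₂ k₃ 1ℚ 1ℚ 1ℚ ℚ.- markov k₁ k₂ k₃ 1ℚ 1ℚ 2ℚ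
k₃-from-markov k₁ k₂ k₃ = solve 3 (λ k l n → n := con 2ℚ :*
    (con 1ℚ :* con 1ℚ :+ con 1ℚ :* con 1ℚ :+ con 1ℚ :* con 1ℚ :+ k :* (con 1ℚ :* con 1ℚ) :+ l :* (con 1ℚ :* con 1ℚ) :+ n :* (con 1ℚ :* con 1ℚ))
    :- (con 1ℚ :* con 1ℚ :+ con 1ℚ :* con 1ℚ :+ con 2ℚ :* con 2ℚ :+ k :* (con 1ℚ :* con 2ℚ) :+ l :* (con 1ℚ :* con 2ℚ) :+ n :* (con 1ℚ :* con 1ℚ)))
    refl (cast (+ k₁)) (cast (+ k₂)) (cast (+ k₃))
  where open +-*-Solver

module _ (k₁ k₂ k₃ : ℕ) where

  Markov : (k l n : ℕ) (a b c : Laurent) → Set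
  Markov k l n = ML.MarkovEquation (𝓜 k₁ k₂ k₃) (κ k) (κ l) (κ n)

  -- Under the homomorphism realizing (u, v, w), the value of M times u v w is one Markov polynomial
  -- by the given equation and the other by the realization.
  markov-values : ∀ {a b c k l n} → Labeled k₁ k₂ k₃ a b c → Markov k l n a b c →
    ∀ u v w → ℚ.Positive u → ℚ.Positive v → ℚ.Positive w → markov k l n u v w ≡ markov k₁ k₂ k₃ u v w
  markov-values {a} {b} {c} {k} {l} {n} L e u v w u>0 v>0 w>0
    with realize k₁ k₂ k₃ L u v w u>0 v>0 w>0
  ... | realization {f} isChar ev-a ev-b ev-c ev-𝓜 = begin
    markov k l n u v w                          ≡⟨ ev-rhs ⟨
    ev rhs                                      ≡⟨ ≈⇒∑ {𝓜 k₁ k₂ k₃ * (a * b * c)} {rhs} e f ⟨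
    ev (𝓜 k₁ k₂ k₃ * (a * b * c))               ≡⟨ ev-*≡ (𝓜 k₁ k₂ k₃) (a * b * c) refl (ev-*≡ (a * b) c (ev-*≡ a b ev-a ev-b) ev-c) ⟩
    ev (𝓜 k₁ k₂ k₃) ℚ.* (u ℚ.* v ℚ.* w)         ≡⟨ ev-𝓜 ⟩
    markov k₁ k₂ k₃ u v w                       ∎
    where
    open ≡-Reasoning
    open Evaluation isChar
    rhs : Laurent
    rhs = a * a + b * b + c * c + κ k * (b * c) + κ l * (a * c) + κ n * (a * b)
    ev-rhs : ev rhs ≡ markov k l n u v w
    ev-rhs =
      ev-+≡ (a * a + b * b + c * c + κ k * (b * c) + κ l * (a * c)) (κ n * (a * b))
        (ev-+≡ (a * a + b * b + c * c + κ k * (b * c)) (κ l * (a * c))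
          (ev-+≡ (a * a + b * b + c * c) (κ k * (b * c))
            (ev-+≡ (a * a + b * b) (c * c)
              (ev-+≡ (a * a) (b * b) (ev-*≡ a a ev-a ev-a) (ev-*≡ b b ev-b ev-b))
              (ev-*≡ c c ev-c ev-c))
            (ev-*≡ (κ k) (b * c) (ev-κ k) (ev-*≡ b c ev-b ev-c)))
          (ev-*≡ (κ l) (a * c) (ev-κ l) (ev-*≡ a c ev-a ev-c)))
        (ev-*≡ (κ n) (a * b) (ev-κ n) (ev-*≡ a b ev-a ev-b))

  -- The parity of an entry of a CGC matrix is given through some labeled cluster, possibly
  -- unrelated to the present one. Here it is matched with the position in the present cluster.
  markov-coefficients : ∀ {a b c k l n} → Labeled k₁ k₂ k₃ a b c → Markov k l n a b c →
    k ≡ k₁ × l ≡ k₂ × n ≡ k₃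
  markov-coefficients {a} {b} {c} {k} {l} {n} L e =
      equal (k₁-from-markov k l n) (at 2ℚ 1ℚ 1ℚ) (k₁-from-markov k₁ k₂ k₃)
    , equal (k₂-from-markov k l n) (at 1ℚ 2ℚ 1ℚ) (k₂-from-markov k₁ k₂ k₃)
    , equal (k₃-from-markov k l n) (at 1ℚ 1ℚ 2ℚ) (k₃-from-markov k₁ k₂ k₃)
    where
    at : ∀ u v w → {{ℚ.Positive u}} → {{ℚ.Positive v}} → {{ℚ.Positive w}} → markov k l n u v w ≡ markov k₁ k₂ k₃ u v w
    at u v w {{p}} {{q}} {{r}} = markov-values {a} {b} {c} L e u v w p q r
    equal : ∀ {i j x y} → cast (+ i) ≡ 2ℚ ℚ.* markov k l n 1ℚ 1ℚ 1ℚ ℚ.- x → x ≡ y →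
      cast (+ j) ≡ 2ℚ ℚ.* markov k₁ k₂ k₃ 1ℚ 1ℚ 1ℚ ℚ.- y → i ≡ j
    equal p q r = ℤ.+-injective (cast-injective
      (trans p (trans (cong₂ (λ x y → 2ℚ ℚ.* x ℚ.- y) (at 1ℚ 1ℚ 1ℚ) q) (sym r))))

-- Mutation of clusters

module _ (k₁ k₂ k₃ : ℕ) where

  Parity-resp : ∀ {y z k} → y ≈ z → Parity k₁ k₂ k₃ y k → Parity k₁ k₂ k₃ z k
  Parity-resp {y} {z} e (pos₁ {a} L y≈) = pos₁ L (≈-trans {z} {y} {a} (≈-sym {y} {z} e) y≈)
  Parity-resp {y} {z} e (pos₂ {b = b} L y≈) = pos₂ L (≈-trans {z} {y} {b} (≈-sym {y} {z} e) y≈)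
  Parity-resp {y} {z} e (pos₃ {c = c} L y≈) = pos₃ L (≈-trans {z} {y} {c} (≈-sym {y} {z} e) y≈)

  LabeledCluster-resp : ∀ {a b c a' b' c'} → a ≈ a' → b ≈ b' → c ≈ c' →
    LabeledCluster k₁ k₂ k₃ a b c → LabeledCluster k₁ k₂ k₃ a' b' c'
  LabeledCluster-resp {a} {b} {c} {a'} {b'} {c'} p q r (x , y , z , L , x≈ , y≈ , z≈) =
    x , y , z , L , ≈-trans {a'} {a} {x} (≈-sym {a} {a'} p) x≈
    , ≈-trans {b'} {b} {y} (≈-sym {b} {b'} q) y≈ , ≈-trans {c'} {c} {z} (≈-sym {c} {c'} r) z≈

  NonLabeledCluster-resp : ∀ {a b c a' b' c'} → a ≈ a' → b ≈ b' → c ≈ c' →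
    NonLabeledCluster k₁ k₂ k₃ a b c → NonLabeledCluster k₁ k₂ k₃ a' b' c'
  NonLabeledCluster-resp {a} {b} {c} {a'} {b'} {c'} p q r = λ where
    (inj₁ L) → inj₁ (LabeledCluster-resp {a} {b} {c} {a'} {b'} {c'} p q r L)
    (inj₂ (inj₁ L)) → inj₂ (inj₁ (LabeledCluster-resp {a} {c} {b} {a'} {c'} {b'} p r q L))
    (inj₂ (inj₂ (inj₁ L))) → inj₂ (inj₂ (inj₁ (LabeledCluster-resp {b} {a} {c} {b'} {a'} {c'} q p r L)))
    (inj₂ (inj₂ (inj₂ (inj₁ L)))) → inj₂ (inj₂ (inj₂ (inj₁ (LabeledCluster-resp {b} {c} {a} {b'} {c'} {a'} q r p L))))
    (inj₂ (inj₂ (inj₂ (inj₂ (inj₁ L))))) →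
      inj₂ (inj₂ (inj₂ (inj₂ (inj₁ (LabeledCluster-resp {c} {a} {b} {c'} {a'} {b'} r p q L)))))
    (inj₂ (inj₂ (inj₂ (inj₂ (inj₂ L))))) →
      inj₂ (inj₂ (inj₂ (inj₂ (inj₂ (LabeledCluster-resp {c} {b} {a} {c'} {b'} {a'} r q p L)))))

  private
    Mk : (k l n : ℕ) (a b c : Laurent) → Set
    Mk = Markov k₁ k₂ k₃
    LC : (a b c : Laurent) → Set
    LC = LabeledCluster k₁ k₂ k₃

  -- Once k is identified with k₁, the relation `ex` is the one required by `mut₁`, and the new
  -- labeled cluster is itself the witness for the parity of y.
  mutate₁ : ∀ {a b c y k l n} → LC a b c → Mk k l n a b c → ML.Exchange (κ k) a y b c →
    LC y b c × Parity k₁ k₂ k₃ y k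
  mutate₁ {a} {b} {c} {y} {k} {l} {n} (a' , b' , c' , L , p , q , r) e ex =
    ((y , b' , c' , L' , (λ m → refl) , q , r) , subst (Parity k₁ k₂ k₃ y) (sym k≡) (pos₁ L' (λ m → refl)))
    where
    ks : k ≡ k₁ × l ≡ k₂ × n ≡ k₃
    ks = markov-coefficients k₁ k₂ k₃ {a'} {b'} {c'} L
      (ML.markov-cong {𝓜 k₁ k₂ k₃} {κ k} {κ l} {κ n} {a} {b} {c} {a'} {b'} {c'} p q r e)
    k≡ : k ≡ k₁
    k≡ = proj₁ ks
    L' : Labeled k₁ k₂ k₃ y b' c'
    L' = mut₁ L (subst (λ k → ML.Exchange (κ k) a' y b' c') k≡
      (ML.exchange-cong {κ k} {a} {y} {b} {c} {a'} {b'} {c'} p q r ex))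

  mutate₂ : ∀ {a b c y k l n} → LC a b c → Mk k l n a b c → ML.Exchange (κ l) b y a c →
    LC a y c × Parity k₁ k₂ k₃ y l
  mutate₂ {a} {b} {c} {y} {k} {l} {n} (a' , b' , c' , L , p , q , r) e ex =
    ((a' , y , c' , L' , p , (λ m → refl) , r) , subst (Parity k₁ k₂ k₃ y) (sym l≡) (pos₂ L' (λ m → refl)))
    where
    ks : k ≡ k₁ × l ≡ k₂ × n ≡ k₃
    ks = markov-coefficients k₁ k₂ k₃ {a'} {b'} {c'} L
      (ML.markov-cong {𝓜 k₁ k₂ k₃} {κ k} {κ l} {κ n} {a} {b} {c} {a'} {b'} {c'} p q r e)
    l≡ : l ≡ k₂
    l≡ = proj₁ (proj₂ ks)
    L' : Labeled k₁ k₂ k₃ a' y c'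
    L' = mut₂ L (subst (λ k → ML.Exchange (κ k) b' y a' c') l≡
      (ML.exchange-cong {κ l} {b} {y} {a} {c} {b'} {a'} {c'} q p r ex))

  mutate₃ : ∀ {a b c y k l n} → LC a b c → Mk k l n a b c → ML.Exchange (κ n) c y a b →
    LC a b y × Parity k₁ k₂ k₃ y n
  mutate₃ {a} {b} {c} {y} {k} {l} {n} (a' , b' , c' , L , p , q , r) e ex =
    ((a' , b' , y , L' , p , q , (λ m → refl)) , subst (Parity k₁ k₂ k₃ y) (sym n≡) (pos₃ L' (λ m → refl)))
    where
    ks : k ≡ k₁ × l ≡ k₂ × n ≡ k₃
    ks = markov-coefficients k₁ k₂ k₃ {a'} {b'} {c'} L
      (ML.markov-cong {𝓜 k₁ k₂ k₃} {κ k} {κ l} {κ n} {a} {b} {c} {a'} {b'} {c'} p q r e)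
    n≡ : n ≡ k₃
    n≡ = proj₂ (proj₂ ks)
    L' : Labeled k₁ k₂ k₃ a' b' y
    L' = mut₃ L (subst (λ k → ML.Exchange (κ k) c' y a' b') n≡
      (ML.exchange-cong {κ n} {c} {y} {a} {b} {c'} {a'} {b'} r p q ex))

  -- The variable y takes the position of b in whichever of the six orders is labeled, so the same
  -- summand is returned.
  mutate : ∀ {a b c y k l n} → NonLabeledCluster k₁ k₂ k₃ a b c → Mk k l n a b c → ML.Exchange (κ l) b y a c →
    NonLabeledCluster k₁ k₂ k₃ a y c × Parity k₁ k₂ k₃ y l
  mutate {a} {b} {c} {y} {k} {l} {n} cluster abc ex = go cluster
    where
    swap₁₂ : ∀ {k l n a b c} → Mk k l n a b c → Mk l k n b a c
    swap₁₂ {k} {l} {n} {a} {b} {c} = ML.markov-swap₁₂ {𝓜 k₁ k₂ k₃} {κ k} {κ l} {κ n} {a} {b} {c}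
    swap₂₃ : ∀ {k l n a b c} → Mk k l n a b c → Mk k n l a c b
    swap₂₃ {k} {l} {n} {a} {b} {c} = ML.markov-swap₂₃ {𝓜 k₁ k₂ k₃} {κ k} {κ l} {κ n} {a} {b} {c}
    acb : Mk k n l a c b
    acb = swap₂₃ {k} {l} {n} {a} {b} {c} abc
    bac : Mk l k n b a c
    bac = swap₁₂ {k} {l} {n} {a} {b} {c} abc
    bca : Mk l n k b c a
    bca = swap₂₃ {l} {k} {n} {b} {a} {c} bac
    cab : Mk n k l c a b
    cab = swap₁₂ {k} {n} {l} {a} {c} {b} acb
    cba : Mk n l k c b a
    cba = swap₂₃ {n} {k} {l} {c} {a} {b} cab
    -- The exchange relation is symmetric in the two fixed variables; this form serves the orders in
    -- which c precedes a.
    xe : ML.Exchange (κ l) b y c a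
    xe = ML.exchange-swap {κ l} {b} {y} {a} {c} ex
    go : NonLabeledCluster k₁ k₂ k₃ a b c → NonLabeledCluster k₁ k₂ k₃ a y c × Parity k₁ k₂ k₃ y l
    go (inj₁ L) = let L' , p = mutate₂ {a} {b} {c} {y} {k} {l} {n} L abc ex in inj₁ L' , p
    go (inj₂ (inj₁ L)) = let L' , p = mutate₃ {a} {c} {b} {y} {k} {n} {l} L acb ex in inj₂ (inj₁ L') , p
    go (inj₂ (inj₂ (inj₁ L))) = let L' , p = mutate₁ {b} {a} {c} {y} {l} {k} {n} L bac ex in inj₂ (inj₂ (inj₁ L')) , p
    go (inj₂ (inj₂ (inj₂ (inj₁ L)))) =
      let L' , p = mutate₁ {b} {c} {a} {y} {l} {n} {k} L bca xe in inj₂ (inj₂ (inj₂ (inj₁ L'))) , p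
    go (inj₂ (inj₂ (inj₂ (inj₂ (inj₁ L))))) =
      let L' , p = mutate₃ {c} {a} {b} {y} {n} {k} {l} L cab xe in inj₂ (inj₂ (inj₂ (inj₂ (inj₁ L')))) , p
    go (inj₂ (inj₂ (inj₂ (inj₂ (inj₂ L))))) =
      let L' , p = mutate₂ {c} {b} {a} {y} {n} {l} {k} L cba xe in inj₂ (inj₂ (inj₂ (inj₂ (inj₂ L')))) , p

-- Assembling the decomposition

to₂ : Mat → ML.Mat₂
to₂ A = ML.mat₂ (m₁₁ A) (m₁₂ A) (m₂₁ A) (m₂₂ A)

from₂ : ML.Mat₂ → Mat
from₂ A = mat (ML.e₁₁ A) (ML.e₁₂ A) (ML.e₂₁ A) (ML.e₂₂ A)

theorem6p13 : (k₁ k₂ k₃ : ℕ) (P Q R : Mat) (a b c : Laurent) →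
    CGCTriple k₁ k₂ k₃ P Q R a b c →
    (∣ a ∣ ⊔ ∣ c ∣) < ∣ b ∣ →
    Σ Mat (λ X → Σ Mat (λ Y → Σ Mat (λ Z →
    MMDecomposition k₁ k₂ k₃ P Q R a b c X Y Z ×
    ((X' Y' Z' : Mat) → MMDecomposition k₁ k₂ k₃ P Q R a b c X' Y' Z' →
    X' ≈M X × Y' ≈M Y × Z' ≈M Z))))
theorem6p13 k₁ k₂ k₃ P Q R a b c
  ((detP , k , parityP , trP) , (_ , l , parityQ , trQ) , (detR , n , parityR , trR) , Q≈ , p≈a , q≈b , r≈c , cluster) _ =
  from₂ D.X₀ , from₂ D.Y₀ , from₂ D.Z₀ , decomposition , uniqueness
  where
  module Tr = ML.Triple (𝓜 k₁ k₂ k₃)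
  -- The operations of the two matrix records agree by definition, so the hypotheses pass over
  -- unchanged.
  module D = Tr.Decompose (to₂ P) (to₂ Q) (to₂ R) detP detR Q≈ {κ k} {κ l} {κ n} trP trQ trR
  p q r y : Laurent
  p = m₁₂ P
  q = m₁₂ Q
  r = m₁₂ R
  y = ML.e₁₂ D.Y₀
  cluster-PQR : NonLabeledCluster k₁ k₂ k₃ p q r
  cluster-PQR = NonLabeledCluster-resp k₁ k₂ k₃ {a} {b} {c} {p} {q} {r}
    (≈-sym {p} {a} p≈a) (≈-sym {q} {b} q≈b) (≈-sym {r} {c} r≈c) cluster
  mutated : NonLabeledCluster k₁ k₂ k₃ p y r × Parity k₁ k₂ k₃ y l
  mutated = mutate k₁ k₂ k₃ {p} {q} {r} {y} {k} {l} {n} cluster-PQR D.markov D.mutation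
  x≈p : p ≈ ML.e₁₂ D.X₀
  x≈p = ≈-sym {ML.e₁₂ D.X₀} {p} D.e₁₂-X₀
  z≈r : r ≈ ML.e₁₂ D.Z₀
  z≈r = ≈-sym {ML.e₁₂ D.Z₀} {r} D.e₁₂-Z₀
  T₂≈T : from₂ Tr.T₂ ≈M T k₁ k₂ k₃
  T₂≈T = (λ m → refl) , cst-0 , (λ m → refl) , λ m → refl
  ≈M-trans : ∀ A B C → A ≈M B → B ≈M C → A ≈M C
  ≈M-trans A B C (e , f , g , h) (e' , f' , g' , h') =
    ≈-trans {m₁₁ A} {m₁₁ B} {m₁₁ C} e e' , ≈-trans {m₁₂ A} {m₁₂ B} {m₁₂ C} f f'
    , ≈-trans {m₂₁ A} {m₂₁ B} {m₂₁ C} g g' , ≈-trans {m₂₂ A} {m₂₂ B} {m₂₂ C} h h'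
  decomposition : MMDecomposition k₁ k₂ k₃ P Q R a b c (from₂ D.X₀) (from₂ D.Y₀) (from₂ D.Z₀)
  decomposition =
    ( (D.det-X₀ , k , Parity-resp k₁ k₂ k₃ {p} {ML.e₁₂ D.X₀} x≈p parityP , D.tr-X₀)
    -- The trace - l serves twice: here for the parity of y, supplied by the mutated cluster, and
    -- below for the parity of b, supplied by the hypothesis on Q.
    , (D.det-Y₀ , l , proj₂ mutated , D.tr-Y₀)
    , (D.det-Z₀ , n , Parity-resp k₁ k₂ k₃ {r} {ML.e₁₂ D.Z₀} z≈r parityR , D.tr-Z₀)
    , ≈M-trans (from₂ D.X₀ · from₂ D.Y₀ · from₂ D.Z₀) (from₂ Tr.T₂) (T k₁ k₂ k₃) D.product T₂≈T
    , NonLabeledCluster-resp k₁ k₂ k₃ {p} {y} {r} {ML.e₁₂ D.X₀} {y} {ML.e₁₂ D.Z₀} x≈p (λ m → refl) z≈r (proj₁ mutated))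
    , D.P-recovered , D.Q-recovered , D.R-recovered
    , (k , Parity-resp k₁ k₂ k₃ {p} {a} p≈a parityP , D.tr-X₀)
    , (l , Parity-resp k₁ k₂ k₃ {q} {b} q≈b parityQ , D.tr-Y₀)
    , (n , Parity-resp k₁ k₂ k₃ {r} {c} r≈c parityR , D.tr-Z₀)
  uniqueness : (X' Y' Z' : Mat) → MMDecomposition k₁ k₂ k₃ P Q R a b c X' Y' Z' →
    X' ≈M from₂ D.X₀ × Y' ≈M from₂ D.Y₀ × Z' ≈M from₂ D.Z₀
  uniqueness X' Y' Z' ((_ , _ , _ , XYZ≈T , _) , P≈ , _ , R≈ , _) =
    D.unique {to₂ X'} {to₂ Y'} {to₂ Z'}
      (≈M-trans (X' · Y' · Z') (T k₁ k₂ k₃) (from₂ Tr.T₂) XYZ≈T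
        ((λ m → refl) , (λ m → sym (cst-0 m)) , (λ m → refl) , λ m → refl)) P≈ R≈
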